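{- Let $\tilde\pi_\Phi$ denote the Carlitz period of $\Phi$. Then $\tilde\pi_\Phi$ can be recovered via the residue $$\operatorname{Res}_{\mathfrak t=\theta}\ \omega_f(\mathfrak t)\,d\frac1{\mathfrak t-\eta}=-\tilde\pi_\Phi .$$
   Context: Let $K=\mathbb F_q(\theta)$, $\iota:\mathbb F_q(t)\to K$, $t\mapsto\theta$. Let $\rho\in\mathbb F_q[t]$ be monic irreducible of degree $N\ge 2$, $\eta$ a root of $\rho$, $\eta^{(i)}=\eta^{q^i}$. Let $\mathcal A$ be the ring of elements of $\mathbb F_q(t)$ regular away from the place $P_\rho$ of $\rho$. Let $K_\rho$ be the completion of $K$ at the place of $\rho(\theta)$, containing $\mathbb F_q(\eta)$ with $\theta-\eta$ a uniformizer, and $\mathbb C_\infty$ the completion of an algebraic closure of $K_\rho$ with $|\theta-\eta|_\eta=q^{ -1}$. Let $H=K(\eta)$, $\sigma\in\mathrm{Gal}(H/K)$: $\eta\mapsto\eta^q$; $x^{\sum a_i\sigma^i}=\prod\sigma^i(x)^{a_i}$; $\Theta=\frac1{\theta-\eta}$, so $\Theta^{\sigma^k}=\frac1{\theta-\eta^{(k)}}$. For $g\in\mathbb C_\infty(t)$, $g^{(k)}$ is obtained by raising the coefficients to the $q^k$-th power ($t$ fixed). Let $f(t)=\frac1{t-\eta}-\frac1{\theta-\eta}$, $\mathbf s_0=1$, $\mathbf s_i=f^{(0)}\cdots f^{(i-1)}$, a $\mathbb C_\infty$-basis of $\mathcal A\otimes_{\mathbb F_q}\mathbb C_\infty$. $\Psi:\mathcal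 A\to\mathbb C_\infty\{\tau\}$ is the rank-one Drinfeld module with $\Psi_a=\sum_ic_i\tau^i$ where $a=\sum_ic_i\mathbf s_i$; its coefficients lie in $H$, and $\Psi^{(2)}$ is obtained by applying $\sigma^2$ to them. Let $C_{0,2}=\sqrt[q-1]{\Theta^{\sigma^2-1}}\,\Theta^{\sigma-1}$, where $\sqrt[q-1]{\Theta^{\sigma^2-1}}$ denotes a $(q-1)$-th root of $\Theta^{\sigma^2-1}$, and let $\Phi_a=C_{0,2}^{ -1}\circ\Psi^{(2)}_a\circ C_{0,2}$ ($a\in\mathcal A$). The Carlitz period of $\Psi^{(2)}$ is $$\tilde\pi=(-\Theta)^{\frac{\sigma^2}{q-1}}\Theta^\sigma\prod_{k=1}^\infty\frac{\Theta^{q^k}}{\Theta^{q^k}-\Theta^{\sigma^k}},$$ where $(-\Theta)^{\frac{\sigma^2}{q-1}}$ denotes a $(q-1)$-th root of $-\Theta^{\sigma^2}$; it generates the period lattice $\tilde\pi\,\iota(\mathcal A)$ of $\Psi^{(2)}$. The Carlitz period of $\Phi$ is $\tilde\pi_\Phi=\tilde\pi/C_{0,2}$; it generates the lattice $\ker\exp_\Phi$ over $\iota(\mathcal A)$, where $\exp_\Phi$ is the exponential function of $\Phi$. The Anderson–Thakur function is $$\omega_f(\mathfrak t)=(-\Theta)^{\frac1{q-1}}\prod_{k=0}^\infty\frac{\Theta^{q^k}}{\Theta^{q^k}-\frac1{\mathfrak t-\eta^{(k)}}},$$ where $(-\Theta)^{\frac1{q-1}}$ denotes a $(q-1)$-th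 root of $-\Theta$. -}

module Defs where

open import Level using (Level; _⊔_; suc)
open import Algebra.Bundles using (CommutativeRing; RawRing; RawSemiring; Semiring)
open import Algebra.Morphism.Structures using (IsRingHomomorphism; IsRingIsomorphism)
import Algebra.Definitions.RawSemiring as RawSemiringDefs
open import Data.Fin.Base using (Fin)
open import Data.Integer.Base as ℤ using (ℤ; +_; -[1+_])
open import Data.List.Base using (List; []; _∷_; map)
open import Data.List.Relation.Unary.All using (All)
open import Data.Nat.Base as ℕ using (ℕ; zero)
open import Data.Nat.GeneralisedArithmetic using (fold)
open import Data.Product.Base using (Σ; Σ-syntax; ∃-syntax; _×_; _,_; proj₁)
open import Data.Rational.Base as ℚ using (ℚ; 1ℚ)
open import Data.Sum.Base using (_⊎_; inj₁; inj₂)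
open import Function.Bundles using (Inverse)
open import Relation.Binary.Core using (REL; Rel)
open import Relation.Binary.Construct.Add.Supremum.NonStrict ℚ._≤_ using (_≤⁺_)
open import Relation.Binary.PropositionalEquality.Core using (_≡_)
import Relation.Binary.PropositionalEquality.Properties as ≡
open import Relation.Nullary.Construct.Add.Supremum using (_⁺; ⊤⁺; [_])
open import Relation.Unary using (Pred)

-- Inversion is total, with the convention 0⁻¹ = 0.
record Field c ℓ : Set (suc (c ⊔ ℓ)) where
  field
    commutativeRing : CommutativeRing c ℓ

  open CommutativeRing commutativeRing public
  open RawSemiringDefs (Semiring.rawSemiring semiring) public using (_^_)

  infix 9 _⁻¹
  field
    _⁻¹      : Carrier → Carrier
    ⁻¹-cong  : ∀ {x y} → x ≈ y → x ⁻¹ ≈ y ⁻¹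
    inverseʳ : ∀ {x} → x ≉ 0# → x * x ⁻¹ ≈ 1#
    0⁻¹      : 0# ⁻¹ ≈ 0#
    1≉0      : 1# ≉ 0#

  infixl 7 _/_
  _/_ : Carrier → Carrier → Carrier
  x / y = x * y ⁻¹

  infixr 8 _^ℤ_
  _^ℤ_ : Carrier → ℤ → Carrier
  x ^ℤ (+ n)    = x ^ n
  x ^ℤ -[1+ n ] = (x ⁻¹) ^ ℕ.suc n

  -- f 0 + … + f (n - 1)  and  f 0 * … * f (n - 1)
  ∑< ∏< : ℕ → (ℕ → Carrier) → Carrier
  ∑< zero      f = 0#
  ∑< (ℕ.suc n) f = ∑< n f + f n
  ∏< zero      f = 1#
  ∏< (ℕ.suc n) f = ∏< n f * f n

  -- The smallest subfield containing S.
  data Generated {p} (S : Pred Carrier p) : Pred Carrier (c ⊔ ℓ ⊔ p) where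
    gen  : ∀ {x} → S x → Generated S x
    resp : ∀ {x y} → x ≈ y → Generated S x → Generated S y
    zer  : Generated S 0#
    one  : Generated S 1#
    add  : ∀ {x y} → Generated S x → Generated S y → Generated S (x + y)
    neg  : ∀ {x} → Generated S x → Generated S (- x)
    mul  : ∀ {x y} → Generated S x → Generated S y → Generated S (x * y)
    inv  : ∀ {x} → Generated S x → Generated S (x ⁻¹)

-- A polynomial is the list of its coefficients, constant term first; trailing
-- zeros are immaterial, so equality is equality of all coefficients.
module Polynomial {c ℓ} (R : CommutativeRing c ℓ) where
  open CommutativeRing R

  Poly : Set c
  Poly = List Carrier

  coeff : Poly → ℕ → Carrier
  coeff []      _         = 0#
  coeff (a ∷ p) zero      = a
  coeff (a ∷ p) (ℕ.suc n) = coeff p n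

  infix 4 _≈ₚ_
  _≈ₚ_ : Rel Poly ℓ
  p ≈ₚ p′ = ∀ n → coeff p n ≈ coeff p′ n

  infixl 6 _+ₚ_
  _+ₚ_ : Poly → Poly → Poly
  []      +ₚ p′       = p′
  (a ∷ p) +ₚ []       = a ∷ p
  (a ∷ p) +ₚ (b ∷ p′) = (a + b) ∷ (p +ₚ p′)

  infixl 7 _*ₚ_
  _*ₚ_ : Poly → Poly → Poly
  []      *ₚ p′ = []
  (a ∷ p) *ₚ p′ = map (a *_) p′ +ₚ (0# ∷ (p *ₚ p′))

  rawSemiringₚ : RawSemiring c ℓ
  rawSemiringₚ = record
    { _≈_ = _≈ₚ_ ; _+_ = _+ₚ_ ; _*_ = _*ₚ_ ; 0# = [] ; 1# = 1# ∷ [] }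

  open RawSemiringDefs rawSemiringₚ public using (Irreducible)

  ⟦_⟧ : Poly → Carrier → Carrier
  ⟦ []    ⟧ x = 0#
  ⟦ a ∷ p ⟧ x = a + x * ⟦ p ⟧ x

  MonicOfDegree : ℕ → Pred Poly ℓ
  MonicOfDegree n p = coeff p n ≈ 1# × (∀ m → n ℕ.< m → coeff p m ≈ 0#)

infixl 6 _+⁺_
_+⁺_ : ℚ ⁺ → ℚ ⁺ → ℚ ⁺
[ r ] +⁺ [ s ] = [ r ℚ.+ s ]
[ _ ] +⁺ ⊤⁺    = ⊤⁺
⊤⁺    +⁺ _     = ⊤⁺

-- A non-archimedean absolute value |x| = b^(- v x), for a fixed base b > 1,
-- recorded through v, with v 0 = ∞.
record ValuedField c ℓ : Set (suc (c ⊔ ℓ)) where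
  field
    𝔽 : Field c ℓ

  open Field 𝔽 public
  open Polynomial commutativeRing

  field
    v      : Carrier → ℚ ⁺
    v-cong : ∀ {x y} → x ≈ y → v x ≡ v y
    v-zero : v 0# ≡ ⊤⁺
    v-sep  : ∀ {x} → v x ≡ ⊤⁺ → x ≈ 0#
    v-*    : ∀ x y → v (x * y) ≡ v x +⁺ v y
    v-+    : ∀ {x y r} → r ≤⁺ v x → r ≤⁺ v y → r ≤⁺ v (x + y)

  Converges : (ℕ → Carrier) → Carrier → Set
  Converges s l = ∀ (r : ℚ) → ∃[ n₀ ] ∀ n → n₀ ℕ.≤ n → [ r ] ≤⁺ v (s n - l)

  Cauchy : (ℕ → Carrier) → Set
  Cauchy s = ∀ (r : ℚ) → ∃[ n₀ ] ∀ m n → n₀ ℕ.≤ m → n₀ ℕ.≤ n → [ r ] ≤⁺ v (s m - s n)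

  Complete : Set c
  Complete = ∀ s → Cauchy s → ∃[ l ] Converges s l

  Closure : ∀ {p} → Pred Carrier p → Pred Carrier (c ⊔ p)
  Closure S x = ∃[ s ] (∀ n → S (s n)) × Converges s x

  Dense : ∀ {p} → Pred Carrier p → Set (c ⊔ p)
  Dense S = ∀ x (r : ℚ) → ∃[ y ] S y × [ r ] ≤⁺ v (x - y)

  AlgebraicOver : ∀ {p} → Pred Carrier p → Pred Carrier (c ⊔ ℓ ⊔ p)
  AlgebraicOver S x = ∃[ n ] ∃[ p ] All S p × MonicOfDegree n p × ⟦ p ⟧ x ≈ 0#

  AlgebraicallyClosed : Set (c ⊔ ℓ)
  AlgebraicallyClosed = ∀ n p → MonicOfDegree (ℕ.suc n) p → ∃[ x ] ⟦ p ⟧ x ≈ 0#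

  -- A limit of functions need not exist everywhere, so such a function is given
  -- by its graph.
  Graph : ∀ p → Set (c ⊔ suc p)
  Graph p = REL Carrier Carrier p

  HasDerivative : (Carrier → Carrier) → Carrier → Carrier → Set (c ⊔ ℓ)
  HasDerivative g t d = ∀ (r : ℚ) → ∃[ δ ] ∀ h → h ≉ 0# → [ δ ] ≤⁺ v h →
    [ r ] ≤⁺ v ((g (t + h) - g t) / h - d)

  -- The differential F dg, identified with F·(dg/dt), its coefficient of dt.
  infix 7 _·d_
  _·d_ : ∀ {p} → Graph p → (Carrier → Carrier) → Graph (c ⊔ ℓ ⊔ p)
  (F ·d g) t w = ∃[ u ] ∃[ d ] F t u × HasDerivative g t d × w ≈ u * d

  -- r is the coefficient a₋₁ of a Laurent expansion G(t) = ∑_{n ≥ -m} aₙ (t - c)ⁿ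
  -- which is valid on a punctured disc around c.
  Residue : ∀ {p} → Graph p → Carrier → Carrier → Set (c ⊔ ℓ ⊔ p)
  Residue G c r = Σ[ m ∈ ℕ ] Σ[ a ∈ (ℤ → Carrier) ] Σ[ δ ∈ ℚ ]
      (∀ n → n ℤ.< ℤ.- (+ m) → a n ≈ 0#)
    × a ℤ.-1ℤ ≈ r
    × (∀ t → t ≉ c → [ δ ] ≤⁺ v (t - c) → ∃[ w ] G t w ×
        Converges (λ J → ∑< J λ j → a (j ℤ.⊖ m) * (t - c) ^ℤ (j ℤ.⊖ m)) w)

record Setting a ℓ c ℓ′ : Set (suc (a ⊔ ℓ ⊔ c ⊔ ℓ′)) where
  field
    𝔽q  : Field a ℓ
    q   : ℕ
    q↔𝔽 : Inverse (≡.setoid (Fin q)) (Field.setoid 𝔽q)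
    ℂ∞  : ValuedField c ℓ′

  private
    module F  = Field 𝔽q
    module F[] = Polynomial F.commutativeRing

  open ValuedField ℂ∞ public
  open Polynomial commutativeRing using (⟦_⟧)

  field
    em       : F.Carrier → Carrier
    em-isHom : IsRingHomomorphism F.rawRing rawRing em

    N             : ℕ
    N≥2           : 2 ℕ.≤ N
    ρ             : F[].Poly
    ρ-monic       : F[].MonicOfDegree N ρ
    ρ-irreducible : F[].Irreducible ρ

    θ                : Carrier
    θ-transcendental : ∀ p → ⟦ map em p ⟧ θ ≈ 0# → p F[].≈ₚ []

    η      : Carrier
    η-root : ⟦ map em ρ ⟧ η ≈ 0#

    -- |θ - η| = q⁻¹.  As ρ(η) = 0, this makes v restrict on K to the valuation
    -- at the place ρ(θ), with uniformizer θ - η.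
    v[θ-η] : v (θ - η) ≡ [ 1ℚ ]

  K : Pred Carrier (a ⊔ c ⊔ ℓ′)
  K = Generated λ x → (∃[ b ] x ≈ em b) ⊎ x ≈ θ

  Kρ : Pred Carrier (a ⊔ c ⊔ ℓ′)
  Kρ = Closure K

  H : Pred Carrier (a ⊔ c ⊔ ℓ′)
  H = Generated λ x → K x ⊎ x ≈ η

  -- ℂ∞ is a completion of an algebraic closure of Kρ.
  field
    ℂ∞-complete  : Complete
    ℂ∞-algClosed : AlgebraicallyClosed
    ℂ∞-dense     : Dense (AlgebraicOver Kρ)

  H-rawRing : RawRing (a ⊔ c ⊔ ℓ′) ℓ′
  H-rawRing = record
    { Carrier = Σ Carrier H
    ; _≈_     = λ { (x , _) (y , _) → x ≈ y }
    ; _+_     = λ { (x , h) (y , k) → x + y , add h k }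
    ; _*_     = λ { (x , h) (y , k) → x * y , mul h k }
    ; -_      = λ { (x , h) → - x , neg h }
    ; 0#      = 0# , zer
    ; 1#      = 1# , one
    }

  ηH : Σ Carrier H
  ηH = η , gen (inj₂ refl)

  field
    σ       : Σ Carrier H → Σ Carrier H
    σ-isAut : IsRingIsomorphism H-rawRing H-rawRing σ
    σ-fixK  : ∀ x → K (proj₁ x) → proj₁ (σ x) ≈ proj₁ x
    σ-η     : proj₁ (σ ηH) ≈ η ^ q

  -- x ^σ (a₀ ∷ a₁ ∷ …) is x^(a₀ + a₁ σ + …).
  infixr 8 _^σ_
  _^σ_ : Σ Carrier H → List ℤ → Carrier
  x ^σ []       = 1#
  x ^σ (n ∷ ns) = proj₁ x ^ℤ n * σ x ^σ ns

  σ^ : ℕ → Σ Carrier H → Carrier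
  σ^ k x = proj₁ (fold x σ k)

  η⁽_⁾ : ℕ → Carrier
  η⁽ k ⁾ = η ^ (q ℕ.^ k)

  Θ : Carrier
  Θ = (θ - η) ⁻¹

  ΘH : Σ Carrier H
  ΘH = Θ , inv (add (gen (inj₁ (gen (inj₂ refl)))) (neg (gen (inj₂ refl))))

  IsRoot : ℕ → Carrier → Carrier → Set ℓ′
  IsRoot n x r = r ^ n ≈ x

  -- C₀,₂, for a chosen root r of Θ^(σ² - 1).
  C₀₂ : Carrier → Carrier
  C₀₂ r = r * ΘH ^σ (ℤ.-1ℤ ∷ ℤ.1ℤ ∷ [])

  -- The Carlitz period of Ψ⁽²⁾, for a chosen root r of - Θ^σ².
  IsPeriodΨ⁽²⁾ : Carrier → Carrier → Set (c ⊔ ℓ′)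
  IsPeriodΨ⁽²⁾ r π̃ = ∃[ P ]
      Converges (λ n → ∏< n λ j → let k = ℕ.suc j in
        Θ ^ (q ℕ.^ k) / (Θ ^ (q ℕ.^ k) - σ^ k ΘH)) P
    × π̃ ≈ r * σ^ 1 ΘH * P

  -- The Carlitz period of Φ = C₀,₂⁻¹ ∘ Ψ⁽²⁾ ∘ C₀,₂, for chosen roots rC in C₀,₂
  -- and rπ in the period of Ψ⁽²⁾.
  IsPeriodΦ : Carrier → Carrier → Carrier → Set (c ⊔ ℓ′)
  IsPeriodΦ rC rπ π̃Φ = ∃[ π̃ ] IsPeriodΨ⁽²⁾ rπ π̃ × π̃Φ ≈ π̃ / C₀₂ rC

  -- The graph of the Anderson–Thakur function, for a chosen root r of - Θ.
  -- Because 0⁻¹ = 0 it may relate junk values at the poles; Residue only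
  -- consults it on a punctured disc.
  ω-f : Carrier → Graph (c ⊔ ℓ′)
  ω-f r t w = ∃[ P ]
      Converges (λ n → ∏< n λ k →
        Θ ^ (q ℕ.^ k) / (Θ ^ (q ℕ.^ k) - (t - η⁽ k ⁾) ⁻¹)) P
    × w ≈ r * P

{-# OPTIONS --safe #-}
module Submission where

-- Put π = θ - η, so v(π) = 1, and t = θ + π y.  By Frobenius the k-th factor of
-- ω_f is (t - η⁽ k ⁾) / (t - θ^(q^k)).  For k = 0 this has a simple pole at θ.
-- For k ≥ 1 it equals 1 + γ / (1 + β y) with v(β) ≥ 0 and v(γ) ≥ k - 1, because
-- v(θ - θ^(q^k)) ≤ 1: otherwise η - η⁽ k ⁾, which is fixed by a power of
-- Frobenius, would have positive valuation, hence vanish, and then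
-- θ - θ^(q^k) = π - π^(q^k) has valuation 1 after all.  So the factors with
-- k ≥ 1 multiply to a power series in y that converges for v(y) ≥ 1, and its
-- constant term is the infinite product in the Carlitz period.  The chosen roots
-- satisfy rω rC = ζ rπ with ζ^(q - 1) = 1, which is the ambiguity in the residue.

open import Defs
open import Level using (_⊔_)
open import Algebra.Bundles using (CommutativeRing)
open import Algebra.Morphism.Structures using (IsRingHomomorphism; IsRingIsomorphism)
import Algebra.Properties.AbelianGroup as AbelianGroupProperties
import Algebra.Properties.CommutativeMonoid.Sum as MonoidSum
import Algebra.Properties.CommutativeSemiring.Exp as Exp
import Algebra.Properties.Group as GroupProperties
import Algebra.Properties.Ring as RingProperties
import Algebra.Properties.Semiring.Mult.TCOptimised as Mult
import Algebra.Solver.Ring as RingSolver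
open import Algebra.Solver.Ring.AlmostCommutativeRing using (fromCommutativeRing; _-Raw-AlmostCommutative⟶_)
open import Data.Fin.Base using (Fin; zero; suc; punchIn; toℕ)
import Data.Fin.Permutation as Perm
import Data.Fin.Properties as Fin
open import Data.Integer.Base as ℤ using (ℤ; +_; -[1+_]; -1ℤ; 0ℤ; 1ℤ)
import Data.Integer.Properties as ℤ
open import Data.List.Base using ([]; _∷_; length; map)
import Data.Maybe.Base as Maybe
open import Data.Nat.Base as ℕ using (ℕ; zero; suc; _∸_)
import Data.Nat.Coprimality as Coprime
open import Data.Nat.GeneralisedArithmetic using (fold)
import Data.Nat.Properties as ℕ
open import Data.Product.Base using (Σ; ∃-syntax; _×_; _,_; proj₁; proj₂)
open import Data.Rational.Base as ℚ using (ℚ; mkℚ; 0ℚ; 1ℚ; *≤*)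
import Data.Rational.Properties as ℚ
import Data.Rational.Unnormalised.Base as ℚᵘ
import Data.Rational.Unnormalised.Properties as ℚᵘ
open import Data.Sum.Base using (_⊎_; inj₁; inj₂)
open import Function.Base using (_∘_)
open import Function.Bundles using (Inverse)
open import Relation.Binary.Construct.Add.Supremum.NonStrict ℚ._≤_ as Sup using (_≤⁺_; [_]; _≤⊤⁺)
open import Relation.Binary.Definitions using (tri<; tri≈; tri>)
open import Relation.Binary.PropositionalEquality as ≡ using (_≡_; _≢_)
import Relation.Binary.Reasoning.Setoid as SetoidReasoning
open import Relation.Nullary using (¬_; Dec; yes; no; contradiction; ¬?; _×-dec_)
open import Relation.Nullary.Construct.Add.Supremum using (_⁺; ⊤⁺; [_])
open import Relation.Nullary.Decidable.Core using (dec⇒maybe)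

-- The derivative of 1/(t - η) contributes -(t - η)^(-2). One power of it cancels the numerator t -
-- η of the factor k = 0; the other is Θ / (1 + y), because t - η = π (1 + y). With h = t - θ, the
-- differential is therefore -(rω Θ / h) times (1 + y)^(-1) times the product over k ≥ 1, and the
-- extra factor (1 + y)^(-1) has constant term 1. On the other side, σΘ cancels between the period
-- and C₀₂, which leaves (rπ / rC) Θ times the same infinite product. Comparing the two thus amounts
-- to comparing rω rC with rπ.
--
-- The analytic work is an exchange of limits: finite products have known expansions, and the
-- expansion of their limit is wanted. Division by 1 + β y keeps coefficients integral, so the
-- growth of v(γ) makes each coefficient converge at a rate independent of its index, and this
-- uniformity permits the exchange.

module IntegerSolver {c ℓ} (R : CommutativeRing c ℓ) where
  open CommutativeRing R hiding (zero)
  open RingProperties ring using (-‿distribˡ-*; -‿distribʳ-*)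
  open GroupProperties +-group using (ε⁻¹≈ε; ⁻¹-involutive)
  open AbelianGroupProperties +-abelianGroup using (⁻¹-∙-comm)
  open Mult semiring using (×-homo-+; ×1-homo-*; 1+×) renaming (_×_ to _·_)
  open SetoidReasoning setoid

  -- With the TCOptimised multiples, the literals 0, 1 and -1 are interpreted
  -- as 0#, 1# and - 1# on the nose.
  fromℤ : ℤ → Carrier
  fromℤ (+ n)    = n · 1#
  fromℤ -[1+ n ] = - (suc n · 1#)

  fromℤ-⊖ : ∀ m n → fromℤ (m ℤ.⊖ n) ≈ m · 1# - n · 1#
  fromℤ-⊖ zero zero = sym (-‿inverseʳ 0#)
  fromℤ-⊖ zero (suc n) = sym (+-identityˡ _)
  fromℤ-⊖ (suc m) zero = sym (trans (+-congˡ ε⁻¹≈ε) (+-identityʳ _))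
  fromℤ-⊖ (suc m) (suc n) = begin
    fromℤ (suc m ℤ.⊖ suc n)                  ≡⟨ ≡.cong fromℤ (ℤ.[1+m]⊖[1+n]≡m⊖n m n) ⟩
    fromℤ (m ℤ.⊖ n)                          ≈⟨ fromℤ-⊖ m n ⟩
    m · 1# - n · 1#                          ≈⟨ +-congʳ (trans (sym (+-identityˡ _)) (+-congʳ (sym (-‿inverseʳ 1#)))) ⟩
    (1# - 1# + m · 1#) - n · 1#              ≈⟨ +-congʳ (trans (+-assoc _ _ _) (trans (+-congˡ (+-comm _ _)) (sym (+-assoc _ _ _)))) ⟩
    (1# + m · 1# - 1#) - n · 1#              ≈⟨ trans (+-assoc _ _ _) (+-congˡ (⁻¹-∙-comm _ _)) ⟩
    (1# + m · 1#) - (1# + n · 1#)            ≈⟨ sym (+-cong (1+× m 1#) (-‿cong (1+× n 1#))) ⟩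
    suc m · 1# - suc n · 1#                  ∎

  fromℤ-neg : ∀ i → fromℤ (ℤ.- i) ≈ - fromℤ i
  fromℤ-neg (+ zero)    = sym ε⁻¹≈ε
  fromℤ-neg (+ suc n)   = refl
  fromℤ-neg -[1+ n ]    = sym (⁻¹-involutive _)

  fromℤ-+ : ∀ i j → fromℤ (i ℤ.+ j) ≈ fromℤ i + fromℤ j
  fromℤ-+ (+ m)    (+ n)    = ×-homo-+ 1# m n
  fromℤ-+ (+ m)    -[1+ n ] = fromℤ-⊖ m (suc n)
  fromℤ-+ -[1+ m ] (+ n)    = trans (fromℤ-⊖ n (suc m)) (+-comm _ _)
  fromℤ-+ -[1+ m ] -[1+ n ] = begin
    - (suc (suc (m ℕ.+ n)) · 1#)     ≡⟨ ≡.cong (λ k → - (suc k · 1#)) (≡.sym (ℕ.+-suc m n)) ⟩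
    - ((suc m ℕ.+ suc n) · 1#)       ≈⟨ -‿cong (×-homo-+ 1# (suc m) (suc n)) ⟩
    - (suc m · 1# + suc n · 1#)      ≈⟨ sym (⁻¹-∙-comm _ _) ⟩
    - (suc m · 1#) - suc n · 1#      ∎

  fromℤ-pos* : ∀ m j → fromℤ (+ m ℤ.* j) ≈ m · 1# * fromℤ j
  fromℤ-pos* m (+ n)    = trans (reflexive (≡.cong fromℤ (≡.sym (ℤ.pos-* m n)))) (×1-homo-* m n)
  fromℤ-pos* m -[1+ n ] = begin
    fromℤ (+ m ℤ.* -[1+ n ])        ≡⟨ ≡.cong fromℤ (≡.sym (ℤ.neg-distribʳ-* (+ m) (+ suc n))) ⟩
    fromℤ (ℤ.- (+ m ℤ.* + suc n))   ≈⟨ fromℤ-neg (+ m ℤ.* + suc n) ⟩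
    - fromℤ (+ m ℤ.* + suc n)       ≈⟨ -‿cong (fromℤ-pos* m (+ suc n)) ⟩
    - (m · 1# * suc n · 1#)         ≈⟨ -‿distribʳ-* _ _ ⟩
    m · 1# * - (suc n · 1#)         ∎

  fromℤ-* : ∀ i j → fromℤ (i ℤ.* j) ≈ fromℤ i * fromℤ j
  fromℤ-* (+ m)    j = fromℤ-pos* m j
  fromℤ-* -[1+ m ] j = begin
    fromℤ (-[1+ m ] ℤ.* j)          ≡⟨ ≡.cong fromℤ (≡.sym (ℤ.neg-distribˡ-* (+ suc m) j)) ⟩
    fromℤ (ℤ.- (+ suc m ℤ.* j))     ≈⟨ fromℤ-neg (+ suc m ℤ.* j) ⟩
    - fromℤ (+ suc m ℤ.* j)         ≈⟨ -‿cong (fromℤ-pos* (suc m) j) ⟩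
    - (suc m · 1# * fromℤ j)        ≈⟨ -‿distribˡ-* _ _ ⟩
    - (suc m · 1#) * fromℤ j        ∎

  private
    morphism : ℤ.+-*-rawRing -Raw-AlmostCommutative⟶ fromCommutativeRing R
    morphism = record
      { ⟦_⟧    = fromℤ
      ; +-homo = fromℤ-+
      ; *-homo = fromℤ-*
      ; -‿homo = fromℤ-neg
      ; 0-homo = refl
      ; 1-homo = refl
      }

  open RingSolver ℤ.+-*-rawRing (fromCommutativeRing R) morphism
    (λ i j → Maybe.map (reflexive ∘ ≡.cong fromℤ) (dec⇒maybe (i ℤ.≟ j)))
    public using (solve; _:=_; _:+_; _:*_; _:-_; :-_; con)

-- Elementary identities in a field with total inversion.

module FieldProperties {c ℓ} (F : Field c ℓ) where
  open Field F hiding (zero)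
  open IntegerSolver commutativeRing
  open Exp commutativeSemiring public hiding (_^_)
  open GroupProperties +-group public using () renaming (x∙y⁻¹≈ε⇒x≈y to x-y≈0⇒x≈y)
  open SetoidReasoning setoid

  inverseˡ : ∀ {x} → x ≉ 0# → x ⁻¹ * x ≈ 1#
  inverseˡ x≉0 = trans (*-comm _ _) (inverseʳ x≉0)

  x*y⁻¹*y≈x : ∀ x {y} → y ≉ 0# → x * y ⁻¹ * y ≈ x
  x*y⁻¹*y≈x x y≉0 = trans (*-assoc _ _ _) (trans (*-congˡ (inverseˡ y≉0)) (*-identityʳ x))

  x*y*y⁻¹≈x : ∀ x {y} → y ≉ 0# → x * y * y ⁻¹ ≈ x
  x*y*y⁻¹≈x x y≉0 = trans (*-assoc _ _ _) (trans (*-congˡ (inverseʳ y≉0)) (*-identityʳ x))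

  *-cancelʳ : ∀ {x y z} → z ≉ 0# → x * z ≈ y * z → x ≈ y
  *-cancelʳ {x} {y} z≉0 eq = trans (sym (x*y*y⁻¹≈x x z≉0)) (trans (*-congʳ eq) (x*y*y⁻¹≈x y z≉0))

  x*y≈0⇒x≈0 : ∀ {x y} → y ≉ 0# → x * y ≈ 0# → x ≈ 0#
  x*y≈0⇒x≈0 y≉0 eq = *-cancelʳ y≉0 (trans eq (sym (zeroˡ _)))

  x*y≉0 : ∀ {x y} → x ≉ 0# → y ≉ 0# → x * y ≉ 0#
  x*y≉0 x≉0 y≉0 eq = x≉0 (x*y≈0⇒x≈0 y≉0 eq)

  x^n≉0 : ∀ {x} n → x ≉ 0# → x ^ n ≉ 0#
  x^n≉0 zero    x≉0 = 1≉0
  x^n≉0 (suc n) x≉0 = x*y≉0 x≉0 (x^n≉0 n x≉0)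

  x*y≈1⇒y≉0 : ∀ {x y} → x * y ≈ 1# → y ≉ 0#
  x*y≈1⇒y≉0 eq y≈0 = 1≉0 (trans (sym eq) (trans (*-congˡ y≈0) (zeroʳ _)))

  x⁻¹≉0 : ∀ {x} → x ≉ 0# → x ⁻¹ ≉ 0#
  x⁻¹≉0 x≉0 = x*y≈1⇒y≉0 (inverseʳ x≉0)

  /-unique : ∀ {x y z} → y ≉ 0# → z * y ≈ x → x / y ≈ z
  /-unique y≉0 eq = trans (*-congʳ (sym eq)) (x*y*y⁻¹≈x _ y≉0)

  ⁻¹-unique : ∀ {x y} → y * x ≈ 1# → x ⁻¹ ≈ y
  ⁻¹-unique eq = trans (sym (*-identityˡ _)) (/-unique (x*y≈1⇒y≉0 eq) eq)

  ⁻¹-distrib-* : ∀ {x y} → x ≉ 0# → y ≉ 0# → (x * y) ⁻¹ ≈ x ⁻¹ * y ⁻¹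
  ⁻¹-distrib-* {x} {y} x≉0 y≉0 = ⁻¹-unique (begin
    x ⁻¹ * y ⁻¹ * (x * y)     ≈⟨ solve 4 (λ x y z w → z :* w :* (x :* y) := (z :* x) :* (w :* y)) refl x y (x ⁻¹) (y ⁻¹) ⟩
    (x ⁻¹ * x) * (y ⁻¹ * y)   ≈⟨ *-cong (inverseˡ x≉0) (inverseˡ y≉0) ⟩
    1# * 1#                   ≈⟨ *-identityˡ 1# ⟩
    1#                        ∎)

  ^-distrib-⁻¹ : ∀ {x} n → x ≉ 0# → (x ⁻¹) ^ n ≈ (x ^ n) ⁻¹
  ^-distrib-⁻¹ zero x≉0 = sym (⁻¹-unique (*-identityˡ 1#))
  ^-distrib-⁻¹ (suc n) x≉0 = trans (*-congˡ (^-distrib-⁻¹ n x≉0)) (sym (⁻¹-distrib-* x≉0 (x^n≉0 n x≉0)))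

  ⁻¹-difference : ∀ {x y} → x ≉ 0# → y ≉ 0# → x ⁻¹ - y ⁻¹ ≈ (y - x) * (x ⁻¹ * y ⁻¹)
  ⁻¹-difference {x} {y} x≉0 y≉0 = begin
    x ⁻¹ - y ⁻¹                                ≈⟨ +-cong (*-identityˡ _) (-‿cong (*-identityˡ _)) ⟨
    1# * x ⁻¹ - 1# * y ⁻¹                      ≈⟨ +-cong (*-congʳ (inverseʳ y≉0)) (-‿cong (*-congʳ (inverseʳ x≉0))) ⟨
    y * y ⁻¹ * x ⁻¹ - x * x ⁻¹ * y ⁻¹          ≈⟨ solve 4 (λ x y z w → y :* w :* z :- x :* z :* w := (y :- x) :* (z :* w)) refl x y (x ⁻¹) (y ⁻¹) ⟩
    (y - x) * (x ⁻¹ * y ⁻¹)                    ∎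

  x-y≉0 : ∀ {x y} → x ≉ y → x - y ≉ 0#
  x-y≉0 x≉y eq = x≉y (x-y≈0⇒x≈y _ _ eq)

  ∏<-cong : ∀ n {f g : ℕ → Carrier} → (∀ k → f k ≈ g k) → ∏< n f ≈ ∏< n g
  ∏<-cong zero    f≈g = refl
  ∏<-cong (suc n) f≈g = *-cong (∏<-cong n f≈g) (f≈g n)

  ∏<-suc : ∀ n (f : ℕ → Carrier) → ∏< (suc n) f ≈ f 0 * ∏< n (f ∘ suc)
  ∏<-suc zero    f = *-comm _ _
  ∏<-suc (suc n) f = trans (*-congʳ (∏<-suc n f)) (*-assoc _ _ _)

  ∑<-cong : ∀ n {f g : ℕ → Carrier} → (∀ k → f k ≈ g k) → ∑< n f ≈ ∑< n g
  ∑<-cong zero    f≈g = refl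
  ∑<-cong (suc n) f≈g = +-cong (∑<-cong n f≈g) (f≈g n)

  ∑<-distribˡ-* : ∀ n c (f : ℕ → Carrier) → ∑< n (λ k → c * f k) ≈ c * ∑< n f
  ∑<-distribˡ-* zero    c f = sym (zeroʳ c)
  ∑<-distribˡ-* (suc n) c f = trans (+-congʳ (∑<-distribˡ-* n c f)) (sym (distribˡ c _ _))

  ∑<-distrib-+ : ∀ n (f g : ℕ → Carrier) → ∑< n (λ k → f k + g k) ≈ ∑< n f + ∑< n g
  ∑<-distrib-+ zero    f g = sym (+-identityˡ 0#)
  ∑<-distrib-+ (suc n) f g = trans (+-congʳ (∑<-distrib-+ n f g))
    (solve 4 (λ a b c d → a :+ b :+ (c :+ d) := (a :+ c) :+ (b :+ d)) refl _ _ _ _)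

-- Polynomial functions and the number of their roots.

module PolynomialFunctions {c ℓ} (F : Field c ℓ) where
  open Field F hiding (zero)
  open FieldProperties F
  open IntegerSolver commutativeRing
  open Polynomial commutativeRing using (⟦_⟧)
  open SetoidReasoning setoid

  -- Horner form of a function rather than a list of coefficients: sums, differences and quotients
  -- are then taken pointwise, and no coefficient has to be computed.
  data Degree< : ℕ → (Carrier → Carrier) → Set (c ⊔ ℓ) where
    zero : ∀ {f} → (∀ x → f x ≈ 0#) → Degree< 0 f
    suc  : ∀ {n f} a g → Degree< n g → (∀ x → f x ≈ a + x * g x) → Degree< (suc n) f

  ⟦⟧-degree : ∀ p → Degree< (length p) ⟦ p ⟧
  ⟦⟧-degree []      = zero λ _ → refl
  ⟦⟧-degree (a ∷ p) = suc a ⟦ p ⟧ (⟦⟧-degree p) λ _ → refl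

  degree-resp : ∀ {n f g} → (∀ x → f x ≈ g x) → Degree< n g → Degree< n f
  degree-resp f≈g (zero eq)      = zero λ x → trans (f≈g x) (eq x)
  degree-resp f≈g (suc a h d eq) = suc a h d λ x → trans (f≈g x) (eq x)

  degree-weaken : ∀ {n f} → Degree< n f → Degree< (suc n) f
  degree-weaken (zero eq)      = suc 0# (λ _ → 0#) (zero λ _ → refl)
    λ x → trans (eq x) (sym (trans (+-identityˡ _) (zeroʳ x)))
  degree-weaken (suc a g d eq) = suc a g (degree-weaken d) eq

  degree-+ : ∀ {n f g} → Degree< n f → Degree< n g → Degree< n (λ x → f x + g x)
  degree-+ (zero eq) (zero eq′) = zero λ x → trans (+-cong (eq x) (eq′ x)) (+-identityˡ 0#)
  degree-+ (suc a f d eq) (suc b g d′ eq′) = suc (a + b) (λ x → f x + g x) (degree-+ d d′) λ x →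
    trans (+-cong (eq x) (eq′ x))
      (solve 5 (λ a b x f g → a :+ x :* f :+ (b :+ x :* g) := a :+ b :+ x :* (f :+ g)) refl a b x (f x) (g x))

  degree-x* : ∀ {n f} → Degree< n f → Degree< (suc n) (λ x → x * f x)
  degree-x* {f = f} d = suc 0# f d λ x → sym (+-identityˡ _)

  degree-const : ∀ {n} → 1 ℕ.≤ n → ∀ a → Degree< n (λ _ → a)
  degree-const {suc zero}    _ a = suc a (λ _ → 0#) (zero λ _ → refl) λ x → sym (trans (+-congˡ (zeroʳ x)) (+-identityʳ a))
  degree-const {suc (suc n)} _ a = degree-weaken (degree-const (ℕ.s≤s ℕ.z≤n) a)

  degree-x^ : ∀ n → Degree< (suc n) (_^ n)
  degree-x^ zero    = degree-const ℕ.≤-refl 1#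
  degree-x^ (suc n) = degree-x* (degree-x^ n)

  -- The leading terms cancel. Writing (x + 1) a - x b as x (a - b) + (a - b) + b turns this into an
  -- induction that needs no binomial coefficients.
  degree-[x+1]^-x^ : ∀ n → Degree< n (λ x → (x + 1#) ^ n - x ^ n)
  degree-[x+1]^-x^ zero    = zero λ _ → -‿inverseʳ 1#
  degree-[x+1]^-x^ (suc n) = degree-resp
    (λ x → solve 3 (λ x a b → (x :+ con 1ℤ) :* a :- x :* b := x :* (a :- b) :+ ((a :- b) :+ b)) refl x ((x + 1#) ^ n) (x ^ n))
    (degree-+ (degree-x* (degree-[x+1]^-x^ n)) (degree-+ (degree-weaken (degree-[x+1]^-x^ n)) (degree-x^ n)))

  factor : ∀ {n f} → Degree< (suc n) f → ∀ a → ∃[ g ] Degree< n g × (∀ x → f x ≈ f a + (x - a) * g x)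
  factor {zero} {f} (suc b g (zero g≈0) eq) a = (λ _ → 0#) , (zero λ _ → refl) , λ x → begin
    f x                        ≈⟨ const x ⟩
    b                          ≈⟨ const a ⟨
    f a                        ≈⟨ +-identityʳ _ ⟨
    f a + 0#                   ≈⟨ +-congˡ (zeroʳ _) ⟨
    f a + (x - a) * 0#         ∎
    where
    const : ∀ x → f x ≈ b
    const x = trans (eq x) (trans (+-congˡ (trans (*-congˡ (g≈0 x)) (zeroʳ x))) (+-identityʳ b))
  factor {suc n} {f} (suc b g d eq) a with factor d a
  ... | h , dh , g≈ = (λ x → g a + x * h x) , suc (g a) h dh (λ _ → refl) , λ x → begin
    f x                                       ≈⟨ eq x ⟩
    b + x * g x                               ≈⟨ +-congˡ (*-congˡ (g≈ x)) ⟩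
    b + x * (g a + (x - a) * h x)             ≈⟨ solve 5 (λ b x a g h → b :+ x :* (g :+ (x :- a) :* h) := b :+ a :* g :+ (x :- a) :* (g :+ x :* h)) refl b x a (g a) (h x) ⟩
    b + a * g a + (x - a) * (g a + x * h x)   ≈⟨ +-congʳ (sym (eq a)) ⟩
    f a + (x - a) * (g a + x * h x)           ∎

  -- Dividing by x - `r zero` leaves a quotient of smaller degree that vanishes at the remaining
  -- points, because these differ from `r zero`.
  zero-of-roots : ∀ {n f} → Degree< n f → (r : Fin n → Carrier) → (∀ i j → i ≢ j → r i ≉ r j) →
                  (∀ i → f (r i) ≈ 0#) → ∀ x → f x ≈ 0#
  zero-of-roots (zero eq) r distinct root x = eq x
  zero-of-roots {f = f} d@(suc _ _ _ _) r distinct root x with factor d (r zero)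
  ... | g , dg , f≈ = trans (f≈′ x) (trans (*-congˡ (g≈0 x)) (zeroʳ _))
    where
    f≈′ : ∀ x → f x ≈ (x - r zero) * g x
    f≈′ x = trans (f≈ x) (trans (+-congʳ (root zero)) (+-identityˡ _))

    g≈0 : ∀ x → g x ≈ 0#
    g≈0 = zero-of-roots dg (r ∘ suc) (λ i j i≢j → distinct (suc i) (suc j) (i≢j ∘ Fin.suc-injective))
      λ i → x*y≈0⇒x≈0 (x-y≉0 (distinct (suc i) zero (λ ())))
              (trans (*-comm _ _) (trans (sym (f≈′ _)) (root (suc i))))

-- Finite fields: every element satisfies x^q = x.

module FiniteField {a ℓ} (F : Field a ℓ) where
  open Field F hiding (zero)
  open FieldProperties F
  open SetoidReasoning setoid
  private module ∏ = MonoidSum *-commutativeMonoid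

  Enumeration : ℕ → Set (a ⊔ ℓ)
  Enumeration q = Inverse (≡.setoid (Fin q)) setoid

  module _ {m} (e : Enumeration (suc m)) where
    open Inverse e using (to; from; to-cong; from-cong; strictlyInverseˡ; strictlyInverseʳ)

    private
      i₀ : Fin (suc m)
      i₀ = from 0#

      to-from : ∀ x → to (from x) ≈ x
      to-from = strictlyInverseˡ

      from-to : ∀ i → from (to i) ≡ i
      from-to = strictlyInverseʳ

      to≉0 : ∀ {i} → i ≢ i₀ → to i ≉ 0#
      to≉0 {i} i≢i₀ eq = i≢i₀ (≡.trans (≡.sym (from-to i)) (from-cong eq))

      -- The index of 0 contributes 1, so a product over all indices is the product of the nonzero
      -- elements, and these need no enumeration of their own.
      unit : Fin (suc m) → Carrier
      unit i with i Fin.≟ i₀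
      ... | yes _ = 1#
      ... | no  _ = to i

      unit≉0 : ∀ i → unit i ≉ 0#
      unit≉0 i with i Fin.≟ i₀
      ... | yes _    = 1≉0
      ... | no  i≢i₀ = to≉0 i≢i₀

      product≉0 : ∀ {n} (f : Fin n → Carrier) → (∀ i → f i ≉ 0#) → ∏.sum f ≉ 0#
      product≉0 {zero}  f f≉0 = 1≉0
      product≉0 {suc n} f f≉0 = x*y≉0 (f≉0 zero) (product≉0 (f ∘ suc) (f≉0 ∘ suc))

    -- Multiplication by b permutes the nonzero elements, so their product is
    -- invariant under scaling each of them by b.
    module _ {b} (b≉0 : b ≉ 0#) where
      private
        π : Perm.Permutation (suc m) (suc m)
        π = Perm.permutation (λ i → from (b * to i)) (λ i → from (b ⁻¹ * to i))
          (λ i → ≡.trans (from-cong (trans (*-congˡ (to-from _)) (trans (sym (*-assoc _ _ _)) (trans (*-congʳ (inverseʳ b≉0)) (*-identityˡ _))))) (from-to i))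
          (λ i → ≡.trans (from-cong (trans (*-congˡ (to-from _)) (trans (sym (*-assoc _ _ _)) (trans (*-congʳ (inverseˡ b≉0)) (*-identityˡ _))))) (from-to i))

        scale : Fin (suc m) → Carrier
        scale i with i Fin.≟ i₀
        ... | yes _ = 1#
        ... | no  _ = b

        scale-i₀ : scale i₀ ≈ 1#
        scale-i₀ with i₀ Fin.≟ i₀
        ... | yes _     = refl
        ... | no  i₀≢i₀ = contradiction ≡.refl i₀≢i₀

        scale-punchIn : ∀ j → scale (punchIn i₀ j) ≈ b
        scale-punchIn j with punchIn i₀ j Fin.≟ i₀
        ... | yes eq = contradiction eq (Fin.punchInᵢ≢i i₀ j)
        ... | no  _  = refl

        unit-π : ∀ i → unit (π Perm.⟨$⟩ʳ i) ≈ unit i * scale i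
        unit-π i with i Fin.≟ i₀ | (π Perm.⟨$⟩ʳ i) Fin.≟ i₀
        ... | yes i≡i₀ | yes _  = sym (*-identityˡ 1#)
        ... | yes i≡i₀ | no neq = contradiction (from-cong (trans (*-congˡ (trans (to-cong i≡i₀) (to-from 0#))) (zeroʳ b))) neq
        ... | no i≢i₀  | yes eq = contradiction (trans (sym (to-from _)) (trans (to-cong eq) (to-from 0#))) (x*y≉0 b≉0 (to≉0 i≢i₀))
        ... | no _     | no _   = trans (to-from _) (*-comm _ _)

      x^[q-1]≈1 : b ^ m ≈ 1#
      x^[q-1]≈1 = *-cancelʳ (product≉0 unit unit≉0) (begin
        b ^ m * ∏.sum unit                   ≈⟨ *-comm _ _ ⟩
        ∏.sum unit * b ^ m                   ≈⟨ *-congˡ (sym ∏scale) ⟩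
        ∏.sum unit * ∏.sum scale             ≈⟨ ∏.∑-distrib-+ unit scale ⟨
        ∏.sum (λ i → unit i * scale i)       ≈⟨ ∏.sum-cong-≋ unit-π ⟨
        ∏.sum (λ i → unit (π Perm.⟨$⟩ʳ i))   ≈⟨ ∏.∑-permute unit π ⟨
        ∏.sum unit                           ≈⟨ *-identityˡ _ ⟨
        1# * ∏.sum unit                      ∎)
        where
        ∏scale : ∏.sum scale ≈ b ^ m
        ∏scale = begin
          ∏.sum scale                                    ≈⟨ ∏.sum-remove {i = i₀} scale ⟩
          scale i₀ * ∏.sum (scale ∘ punchIn i₀)          ≈⟨ *-cong scale-i₀ (∏.sum-cong-≋ scale-punchIn) ⟩
          1# * ∏.sum {m} (λ _ → b)                       ≈⟨ *-identityˡ _ ⟩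
          ∏.sum {m} (λ _ → b)                            ≈⟨ ∏.sum-replicate m ⟩
          b ^ m                                          ∎

  2≤q : ∀ {q} → Enumeration q → 2 ℕ.≤ q
  2≤q {zero} e with () ← Inverse.from e 0#
  2≤q {suc zero} e = contradiction (trans (sym (Inverse.strictlyInverseˡ e 1#))
    (trans (Inverse.to-cong e (fin1 (Inverse.from e 1#) (Inverse.from e 0#))) (Inverse.strictlyInverseˡ e 0#))) 1≉0
    where
    fin1 : (i j : Fin 1) → i ≡ j
    fin1 zero zero = ≡.refl
  2≤q {suc (suc q)} e = ℕ.s≤s (ℕ.s≤s ℕ.z≤n)

  x^q≈x : ∀ {q} → Enumeration q → ∀ x → x ^ q ≈ x
  x^q≈x {zero} e x with () ← Inverse.from e x
  x^q≈x {suc m} e x with Inverse.from e x Fin.≟ Inverse.from e 0#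
  ... | yes eq = trans (*-congʳ x≈0) (trans (zeroˡ _) (sym x≈0))
    where
    x≈0 : x ≈ 0#
    x≈0 = trans (sym (Inverse.strictlyInverseˡ e x)) (trans (Inverse.to-cong e eq) (Inverse.strictlyInverseˡ e 0#))
  ... | no neq = trans (*-congˡ (x^[q-1]≈1 e (neq ∘ Inverse.from-cong e))) (*-identityʳ x)

-- Natural bounds in the value group with infinity.

ι : ℕ → ℚ
ι n = mkℚ (+ n) 0 (Coprime.sym (Coprime.1-coprimeTo n))

ι-+ : ∀ m n → ι (m ℕ.+ n) ≡ ι m ℚ.+ ι n
ι-+ m n = ℚ.toℚᵘ-injective (ℚᵘ.≃-trans
  (ℚᵘ.*≡* (≡.cong (ℤ._* 1ℤ) (≡.sym (≡.cong₂ ℤ._+_ (ℤ.*-identityʳ (+ m)) (ℤ.*-identityʳ (+ n))))))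
  (ℚᵘ.≃-sym (ℚ.toℚᵘ-homo-+ (ι m) (ι n))))

ι-mono : ∀ {m n} → m ℕ.≤ n → ι m ℚ.≤ ι n
ι-mono m≤n = *≤* (ℤ.*-monoʳ-≤-nonNeg (+ 1) (ℤ.+≤+ m≤n))

ι-cancel : ∀ {m n} → ι m ℚ.≤ ι n → m ℕ.≤ n
ι-cancel {m} {n} (*≤* le) = ℤ.drop‿+≤+ (≡.subst₂ ℤ._≤_ (ℤ.*-identityʳ (+ m)) (ℤ.*-identityʳ (+ n)) le)

archimedean : ∀ r → ∃[ n ] r ℚ.≤ ι n
archimedean (mkℚ (+ p) d _) = p , *≤* (≡.subst₂ ℤ._≤_ (ℤ.pos-* p 1) (ℤ.pos-* p (suc d)) (ℤ.+≤+ (ℕ.*-monoʳ-≤ p (ℕ.s≤s ℕ.z≤n))))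
archimedean (mkℚ -[1+ p ] d _) = 0 , *≤* ℤ.-≤+

+⁺-mono-≤ : ∀ {a b x y} → [ a ] ≤⁺ x → [ b ] ≤⁺ y → [ a ℚ.+ b ] ≤⁺ x +⁺ y
+⁺-mono-≤ [ p ]     [ q ]     = [ ℚ.+-mono-≤ p q ]
+⁺-mono-≤ [ p ]     (_ ≤⊤⁺)   = _ ≤⊤⁺
+⁺-mono-≤ (_ ≤⊤⁺)   q         = _ ≤⊤⁺

+⁺-mono-≥ : ∀ {a b x y} → x ≤⁺ [ a ] → y ≤⁺ [ b ] → x +⁺ y ≤⁺ [ a ℚ.+ b ]
+⁺-mono-≥ [ p ] [ q ] = [ ℚ.+-mono-≤ p q ]

+⁺-cancelʳ-≤ : ∀ {a b x y} → [ a ℚ.+ b ] ≤⁺ x +⁺ y → y ≤⁺ [ b ] → [ a ] ≤⁺ x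
+⁺-cancelʳ-≤ {a} {b} {[ r ]} {[ s ]} [ p ] [ q ] with a ℚ.≤? r
... | yes a≤r = [ a≤r ]
... | no  a≰r = contradiction (ℚ.<-≤-trans (ℚ.+-mono-<-≤ (ℚ.≰⇒> a≰r) q) p) (ℚ.<-irrefl ≡.refl)
+⁺-cancelʳ-≤ {x = ⊤⁺} _ _ = _ ≤⊤⁺

+⁺-idem : ∀ {x} → x +⁺ x ≡ x → x ≡ ⊤⁺ ⊎ x ≡ [ 0ℚ ]
+⁺-idem {⊤⁺}    _  = inj₁ ≡.refl
+⁺-idem {[ r ]} eq = inj₂ (≡.cong [_] (GroupProperties.identityʳ-unique ℚ.+-0-group r r ([]-injective eq)))
  where
  []-injective : ∀ {r s : ℚ} → _≡_ {A = ℚ ⁺} [ r ] [ s ] → r ≡ s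
  []-injective ≡.refl = ≡.refl

≤⁺-refl : ∀ {x} → x ≤⁺ x
≤⁺-refl = Sup.≤⁺-reflexive-≡ ℚ.≤-reflexive ≡.refl

≤⁺-trans : ∀ {x y z} → x ≤⁺ y → y ≤⁺ z → x ≤⁺ z
≤⁺-trans = Sup.≤⁺-trans ℚ.≤-trans

≤⁺-total : ∀ x y → x ≤⁺ y ⊎ y ≤⁺ x
≤⁺-total = Sup.≤⁺-total ℚ.≤-total

-- Ultrametric estimates and limits.

module Valuation {c ℓ} (V : ValuedField c ℓ) where
  open ValuedField V hiding (zero)
  open FieldProperties 𝔽
  open IntegerSolver commutativeRing

  -- Natural bounds suffice, since `archimedean` replaces any rational precision by a natural one.
  -- As v 0 is infinite, an upper bound `v≤` also certifies that an element is nonzero.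
  v≥ v≤ : ℕ → Carrier → Set
  v≥ n x = [ ι n ] ≤⁺ v x
  v≤ n x = v x ≤⁺ [ ι n ]

  v≥-resp : ∀ {n x y} → x ≈ y → v≥ n x → v≥ n y
  v≥-resp x≈y = ≡.subst ([ _ ] ≤⁺_) (v-cong x≈y)

  v≤-resp : ∀ {n x y} → x ≈ y → v≤ n x → v≤ n y
  v≤-resp x≈y = ≡.subst (_≤⁺ [ _ ]) (v-cong x≈y)

  v≥-mono : ∀ {m n x} → m ℕ.≤ n → v≥ n x → v≥ m x
  v≥-mono m≤n = ≤⁺-trans [ ι-mono m≤n ]

  v≥-0# : ∀ n → v≥ n 0#
  v≥-0# n = ≡.subst ([ _ ] ≤⁺_) (≡.sym v-zero) (_ ≤⊤⁺)

  v≥-+ : ∀ {n x y} → v≥ n x → v≥ n y → v≥ n (x + y)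
  v≥-+ = v-+

  v≥-* : ∀ {m n x y} → v≥ m x → v≥ n y → v≥ (m ℕ.+ n) (x * y)
  v≥-* {m} {n} p q = ≡.subst₂ _≤⁺_ (≡.cong [_] (≡.sym (ι-+ m n))) (≡.sym (v-* _ _)) (+⁺-mono-≤ p q)

  v≤-* : ∀ {m n x y} → v≤ m x → v≤ n y → v≤ (m ℕ.+ n) (x * y)
  v≤-* {m} {n} p q = ≡.subst₂ _≤⁺_ (≡.sym (v-* _ _)) (≡.cong [_] (≡.sym (ι-+ m n))) (+⁺-mono-≥ p q)

  v≥-cancelʳ : ∀ {m n x y} → v≥ (m ℕ.+ n) (x * y) → v≤ n y → v≥ m x
  v≥-cancelʳ {m} {n} p = +⁺-cancelʳ-≤ (≡.subst₂ _≤⁺_ (≡.cong [_] (ι-+ m n)) (v-* _ _) p)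

  v≤⇒≉0 : ∀ {n x} → v≤ n x → x ≉ 0#
  v≤⇒≉0 p x≈0 with () ← ≡.subst (_≤⁺ [ _ ]) (≡.trans (v-cong x≈0) v-zero) p

  v≥⇒≰ : ∀ {n x} → v≥ (suc n) x → ¬ v≤ n x
  v≥⇒≰ p q with ≤⁺-trans p q
  ... | [ le ] = ℕ.1+n≰n (ι-cancel le)

  v≤-total : ∀ n x → v≤ n x ⊎ v≥ n x
  v≤-total n x = ≤⁺-total (v x) [ ι n ]

  infix 4 _≟0
  -- Infinity is a separate constructor of the value type and is attained only at 0, so inspecting
  -- `v x` decides the question.
  _≟0 : ∀ x → Dec (x ≈ 0#)
  x ≟0 with v x in eq
  ... | ⊤⁺    = yes (v-sep eq)
  ... | [ r ] = no λ x≈0 → case≢ (≡.trans (≡.sym eq) (≡.trans (v-cong x≈0) v-zero))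
    where
    case≢ : ∀ {r} → [ r ] ≢ ⊤⁺
    case≢ ()

  _≟_ : ∀ x y → Dec (x ≈ y)
  x ≟ y with x - y ≟0
  ... | yes eq = yes (x-y≈0⇒x≈y x y eq)
  ... | no neq = no λ x≈y → neq (trans (+-congʳ x≈y) (-‿inverseʳ y))

  v≤-exists : ∀ {x} → x ≉ 0# → ∃[ n ] v≤ n x
  v≤-exists {x} x≉0 with v x in eq
  ... | ⊤⁺    = contradiction (v-sep eq) x≉0
  ... | [ r ] = let n , r≤n = archimedean r in n , [ r≤n ]

  v≥-all⇒≈0 : ∀ {x} → (∀ n → v≥ n x) → x ≈ 0#
  v≥-all⇒≈0 {x} p with x ≟0
  ... | yes x≈0 = x≈0
  ... | no  x≉0 = let n , x≤n = v≤-exists x≉0 in contradiction x≤n (v≥⇒≰ (p (suc n)))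

  v-1# : v 1# ≡ [ 0ℚ ]
  v-1# with +⁺-idem (≡.trans (≡.sym (v-* 1# 1#)) (v-cong (*-identityˡ 1#)))
  ... | inj₁ v1≡⊤ = contradiction (v-sep v1≡⊤) 1≉0
  ... | inj₂ v1≡0 = v1≡0

  v≥-1# : v≥ 0 1#
  v≥-1# = ≡.subst ([ _ ] ≤⁺_) (≡.sym v-1#) [ ℚ.≤-refl ]

  v≤-1# : v≤ 0 1#
  v≤-1# = ≡.subst (_≤⁺ [ _ ]) (≡.sym v-1#) [ ℚ.≤-refl ]

  -- If the valuation of -1 is at most 0, cancelling one factor from (-1)(-1) = 1 shows that it is
  -- also at least 0.
  v≥-neg1 : v≥ 0 (- 1#)
  v≥-neg1 with v≤-total 0 (- 1#)
  ... | inj₂ p = p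
  ... | inj₁ p = v≥-cancelʳ (v≥-resp (solve 0 (con 1ℤ := :- con 1ℤ :* :- con 1ℤ) refl) v≥-1#) p

  v≥-neg : ∀ {n x} → v≥ n x → v≥ n (- x)
  v≥-neg p = v≥-resp (solve 1 (λ x → :- con 1ℤ :* x := :- x) refl _) (v≥-* v≥-neg1 p)

  v≥-minus : ∀ {n x y} → v≥ n x → v≥ n y → v≥ n (x - y)
  v≥-minus p q = v≥-+ p (v≥-neg q)

  v≥-^ : ∀ {x} n → v≥ 1 x → v≥ n (x ^ n)
  v≥-^ zero    p = v≥-1#
  v≥-^ (suc n) p = v≥-* p (v≥-^ n p)

  -- A summand that is strictly smaller in absolute value cannot cancel x: otherwise x = (x + y) - y
  -- would itself be too small.
  v≤-+ : ∀ {n x y} → v≤ n x → v≥ (suc n) y → v≤ n (x + y)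
  v≤-+ {n} {x} {y} p q with ≤⁺-total (v (x + y)) (v (- y))
  ... | inj₁ le = ≤⁺-trans (≡.subst (v (x + y) ≤⁺_) (v-cong x+y-y≈x) (v-+ {x + y} {(- y)} ≤⁺-refl le)) p
    where x+y-y≈x = solve 2 (λ x y → x :+ y :- y := x) refl x y
  ... | inj₂ le = contradiction p (v≥⇒≰ (v≥-resp x+y-y≈x (v≥-minus (≤⁺-trans (v≥-neg q) le) q)))
    where x+y-y≈x = solve 2 (λ x y → x :+ y :- y := x) refl x y

  1+u-v≤ : ∀ {u} → v≥ 1 u → v≤ 0 (1# + u)
  1+u-v≤ = v≤-+ v≤-1#

  1+u≉0 : ∀ {u} → v≥ 1 u → 1# + u ≉ 0#
  1+u≉0 = v≤⇒≉0 ∘ 1+u-v≤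

  v≥-/ : ∀ {m n x y} → v≥ (m ℕ.+ n) x → v≤ n y → v≥ m (x / y)
  v≥-/ p q = v≥-cancelʳ (v≥-resp (sym (x*y⁻¹*y≈x _ (v≤⇒≉0 q))) p) q

  v≥-⁻¹ : ∀ {u} → v≥ 1 u → v≥ 0 ((1# + u) ⁻¹)
  v≥-⁻¹ p = v≥-resp (*-identityˡ _) (v≥-/ v≥-1# (1+u-v≤ p))

  v≥⇒Converges : ∀ {s l} → (∀ k → ∃[ n₀ ] ∀ n → n₀ ℕ.≤ n → v≥ k (s n - l)) → Converges s l
  v≥⇒Converges p r = let k , r≤k = archimedean r ; n₀ , q = p k in n₀ , λ n n₀≤n → ≤⁺-trans [ r≤k ] (q n n₀≤n)

  Converges⇒v≥ : ∀ {s l} → Converges s l → ∀ k → ∃[ n₀ ] ∀ n → n₀ ℕ.≤ n → v≥ k (s n - l)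
  Converges⇒v≥ conv k = conv (ι k)

  Converges-cong : ∀ {s s′ l l′} → (∀ n → s n ≈ s′ n) → l ≈ l′ → Converges s l → Converges s′ l′
  Converges-cong s≈ l≈ conv = v≥⇒Converges λ k → let n₀ , p = Converges⇒v≥ conv k in
    n₀ , λ n n₀≤n → v≥-resp (+-cong (s≈ n) (-‿cong l≈)) (p n n₀≤n)

  Converges-+ : ∀ {s s′ l l′} → Converges s l → Converges s′ l′ → Converges (λ n → s n + s′ n) (l + l′)
  Converges-+ conv conv′ = v≥⇒Converges λ k →
    let m , p = Converges⇒v≥ conv k ; m′ , p′ = Converges⇒v≥ conv′ k in
    m ℕ.⊔ m′ , λ n le → v≥-resp
      (solve 4 (λ a b c d → (a :- b) :+ (c :- d) := (a :+ c) :- (b :+ d)) refl _ _ _ _)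
      (v≥-+ (p n (ℕ.≤-trans (ℕ.m≤m⊔n m m′) le)) (p′ n (ℕ.≤-trans (ℕ.m≤n⊔m m m′) le)))

  Converges-const : ∀ l → Converges (λ _ → l) l
  Converges-const l = v≥⇒Converges λ k → 0 , λ _ _ → v≥-resp (sym (-‿inverseʳ l)) (v≥-0# k)

  Converges-* : ∀ c {s l} → Converges s l → Converges (λ n → c * s n) (c * l)
  Converges-* c conv with c ≟0
  ... | yes c≈0 = Converges-cong (λ n → sym (trans (*-congʳ c≈0) (zeroˡ _))) (sym (trans (*-congʳ c≈0) (zeroˡ _))) (Converges-const 0#)
  -- Precision `k + m` absorbs the factor c: multiplying the error by `c ⁻¹`, whose valuation is at
  -- most m, gives back the error of s.
  ... | no c≉0 = let m , c⁻¹≤m = v≤-exists (x⁻¹≉0 c≉0) in v≥⇒Converges λ k →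
    let n₀ , p = Converges⇒v≥ conv (k ℕ.+ m) in n₀ , λ n le → v≥-cancelʳ
      (v≥-resp (sym (trans (*-congʳ (solve 3 (λ c a b → c :* a :- c :* b := (a :- b) :* c) refl c _ _)) (x*y*y⁻¹≈x _ c≉0))) (p n le)) c⁻¹≤m

  Converges-shift : ∀ {s l} → Converges (s ∘ suc) l → Converges s l
  Converges-shift conv = v≥⇒Converges λ k → let n₀ , p = Converges⇒v≥ conv k in
    suc n₀ , λ { (suc n) (ℕ.s≤s le) → p n le }

  -- The increments have valuation tending to infinity, so the strong triangle
  -- inequality alone makes s Cauchy.
  limit : Complete → ∀ s → (∀ n → v≥ n (s (suc n) - s n)) →
          ∃[ l ] Converges s l × (∀ n → v≥ n (s n - l))
  limit complete s step = l , conv , λ n →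
    let m , p = Converges⇒v≥ conv n in v≥-resp
      (solve 3 (λ a b c → (b :- c) :- (b :- a) := a :- c) refl _ _ _)
      (v≥-minus (p (m ℕ.+ n) (ℕ.m≤m+n m n)) (tail m n))
    where
    tail : ∀ m n → v≥ n (s (m ℕ.+ n) - s n)
    tail zero    n = v≥-resp (sym (-‿inverseʳ _)) (v≥-0# n)
    tail (suc m) n = v≥-resp (solve 3 (λ a b c → (a :- b) :+ (b :- c) := a :- c) refl _ _ _)
      (v≥-+ (v≥-mono (ℕ.m≤n+m n m) (step (m ℕ.+ n))) (tail m n))

    tail′ : ∀ m n → n ℕ.≤ m → v≥ n (s m - s n)
    tail′ m n n≤m = ≡.subst (λ m → v≥ n (s m - s n)) (ℕ.m∸n+n≡m n≤m) (tail (m ∸ n) n)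

    cauchy : Cauchy s
    cauchy r = let k , r≤k = archimedean r in k , λ m n k≤m k≤n → ≤⁺-trans [ r≤k ]
      (v≥-resp (solve 3 (λ a b c → (a :- c) :- (b :- c) := a :- b) refl _ _ _)
        (v≥-minus (tail′ m k k≤m) (tail′ n k k≤n)))

    l = proj₁ (complete s cauchy)
    conv = proj₂ (complete s cauchy)

-- Power series on v(y) ≥ 1 and expansion of an infinite product.

module PowerSeries {c ℓ} (V : ValuedField c ℓ) where
  open ValuedField V hiding (zero)
  open FieldProperties 𝔽
  open IntegerSolver commutativeRing
  open Valuation V
  open SetoidReasoning setoid

  Series : Set c
  Series = ℕ → Carrier

  partialSum : Series → Carrier → ℕ → Carrier
  partialSum p y J = ∑< J λ j → p j * y ^ j

  Integral : Series → Set
  Integral p = ∀ n → v≥ 0 (p n)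

  𝟙 : Series
  𝟙 zero    = 1#
  𝟙 (suc n) = 0#

  -- The quotient of the series p in y by 1 + β y.
  divide : Carrier → Series → Series
  divide β p zero    = p zero
  divide β p (suc n) = p (suc n) - β * divide β p n

  divide-integral : ∀ {β p} → v≥ 0 β → Integral p → Integral (divide β p)
  divide-integral vβ vp zero    = vp zero
  divide-integral vβ vp (suc n) = v≥-minus (vp (suc n)) (v≥-* vβ (divide-integral vβ vp n))

  -- Multiplying back by 1 + β y telescopes. Only a boundary term at y^(J + 1) survives, and it
  -- tends to 0 when v(y) ≥ 1 and the coefficients are integral.
  partialSum-divide : ∀ β p y J → partialSum (divide β p) y (suc J) * (1# + β * y)
                      ≈ partialSum p y (suc J) + β * divide β p J * y ^ suc J
  partialSum-divide β p y zero =
    solve 3 (λ β p y → (con 0ℤ :+ p :* con 1ℤ) :* (con 1ℤ :+ β :* y) := con 0ℤ :+ p :* con 1ℤ :+ β :* p :* (y :* con 1ℤ)) refl β (p 0) y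
  partialSum-divide β p y (suc J) = begin
    (Q + q * z) * (1# + β * y)                       ≈⟨ solve 5 (λ Q q z β y → (Q :+ q :* z) :* (con 1ℤ :+ β :* y) := Q :* (con 1ℤ :+ β :* y) :+ q :* z :* (con 1ℤ :+ β :* y)) refl Q q z β y ⟩
    Q * (1# + β * y) + q * z * (1# + β * y)          ≈⟨ +-congʳ (partialSum-divide β p y J) ⟩
    P + β * q₀ * z + (p₁ - β * q₀) * z * (1# + β * y) ≈⟨ solve 6 (λ P p₁ q₀ z β y → P :+ β :* q₀ :* z :+ (p₁ :- β :* q₀) :* z :* (con 1ℤ :+ β :* y)
                                                                 := P :+ p₁ :* z :+ β :* (p₁ :- β :* q₀) :* (y :* z)) refl P p₁ q₀ z β y ⟩
    P + p₁ * z + β * q * (y * z)                     ∎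
    where
    P = partialSum p y (suc J)
    Q = partialSum (divide β p) y (suc J)
    p₁ = p (suc J)
    q₀ = divide β p J
    q = divide β p (suc J)
    z = y ^ suc J

  divide-converges : ∀ {β p y w} → v≥ 0 β → Integral p → v≥ 1 y → Converges (partialSum p y) w →
                     Converges (partialSum (divide β p) y) (w / (1# + β * y))
  divide-converges {β} {p} {y} {w} vβ vp vy conv = v≥⇒Converges λ k →
    let n₀ , close = Converges⇒v≥ conv k in suc (n₀ ℕ.⊔ k) , λ { (suc J) (ℕ.s≤s le) →
      v≥-resp (sym (quotient J))
        (v≥-mono (ℕ.m≤m+n k 0) (v≥-*
          (v≥-+ (close (suc J) (ℕ.≤-trans (ℕ.m≤m⊔n n₀ k) (ℕ.≤-trans le (ℕ.n≤1+n J))))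
                (v≥-* (v≥-* vβ (divide-integral vβ vp J)) (v≥-mono (ℕ.≤-trans (ℕ.m≤n⊔m n₀ k) (ℕ.≤-trans le (ℕ.n≤1+n J))) (v≥-^ (suc J) vy))))
          (v≥-⁻¹ βy))) }
    where
    βy : v≥ 1 (β * y)
    βy = v≥-* vβ vy

    u = 1# + β * y

    quotient : ∀ J → partialSum (divide β p) y (suc J) - w / u
               ≈ (partialSum p y (suc J) - w + β * divide β p J * y ^ suc J) * u ⁻¹
    quotient J = begin
      Q - w / u                    ≈⟨ +-congʳ (sym (x*y*y⁻¹≈x Q (1+u≉0 βy))) ⟩
      Q * u * u ⁻¹ - w * u ⁻¹      ≈⟨ solve 3 (λ a b c → a :* c :- b :* c := (a :- b) :* c) refl (Q * u) w (u ⁻¹) ⟩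
      (Q * u - w) * u ⁻¹           ≈⟨ *-congʳ (+-congʳ (partialSum-divide β p y J)) ⟩
      (partialSum p y (suc J) + e - w) * u ⁻¹ ≈⟨ *-congʳ (solve 3 (λ a b c → a :+ b :- c := a :- c :+ b) refl _ e w) ⟩
      (partialSum p y (suc J) - w + e) * u ⁻¹ ∎
      where
      Q = partialSum (divide β p) y (suc J)
      e = β * divide β p J * y ^ suc J

  𝟙-integral : Integral 𝟙
  𝟙-integral zero    = v≥-1#
  𝟙-integral (suc n) = v≥-0# 0

  𝟙-converges : ∀ y → Converges (partialSum 𝟙 y) 1#
  𝟙-converges y = v≥⇒Converges λ k → 1 , λ { (suc J) _ → v≥-resp (sym (trans (+-congʳ (sum J)) (-‿inverseʳ 1#))) (v≥-0# k) }
    where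
    sum : ∀ J → partialSum 𝟙 y (suc J) ≈ 1#
    sum zero    = trans (+-identityˡ _) (*-identityˡ 1#)
    sum (suc J) = trans (+-cong (sum J) (zeroˡ _)) (+-identityʳ 1#)

  partialSum-close : ∀ {k p p′ y} → v≥ 0 y → (∀ j → v≥ k (p j - p′ j)) → ∀ J → v≥ k (partialSum p y J - partialSum p′ y J)
  partialSum-close {k} vy close zero = v≥-resp (sym (-‿inverseʳ 0#)) (v≥-0# k)
  partialSum-close {k} {y = y} vy close (suc J) = v≥-resp
    (solve 5 (λ a b c d z → a :- b :+ (c :- d) :* z := a :+ c :* z :- (b :+ d :* z)) refl _ _ _ _ _)
    (v≥-+ (partialSum-close vy close J) (v≥-mono (ℕ.m≤m+n k 0) (v≥-* (close J) (y^ J))))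
    where
    y^ : ∀ n → v≥ 0 (y ^ n)
    y^ zero    = v≥-1#
    y^ (suc n) = v≥-* vy (y^ n)

  -- The hypothesis on coefficients is uniform in j, so for integral y the partial sums are close
  -- uniformly in J. One stage m = n ⊔ k then serves both the values f and the coefficients.
  uniform-limit : ∀ {p : ℕ → Series} {a y w} {f : ℕ → Carrier} → v≥ 0 y → (∀ k j → v≥ k (p k j - a j)) →
                  (∀ k → Converges (partialSum (p k) y) (f k)) → Converges f w → Converges (partialSum a y) w
  uniform-limit vy close conv f→w = v≥⇒Converges λ k →
    let n , p = Converges⇒v≥ f→w k ; m = n ℕ.⊔ k ; n₀ , p′ = Converges⇒v≥ (conv m) k in n₀ , λ J le → v≥-resp
      (solve 4 (λ a b f w → b :- f :+ (f :- w) :- (b :- a) := a :- w) refl _ _ _ _)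
      (v≥-minus (v≥-+ (p′ J le) (p m (ℕ.m≤m⊔n n k))) (v≥-mono (ℕ.m≤n⊔m n k) (partialSum-close vy (close m) J)))

  module ProductExpansion (complete : Complete) (β γ : ℕ → Carrier)
                          (vβ : ∀ k → v≥ 0 (β k)) (vγ : ∀ k → v≥ k (γ k)) where

    factor : Carrier → ℕ → Carrier
    factor y k = 1# + γ k / (1# + β k * y)

    private
      -- The start is the series of 1 / (1 + y), left over from the differential. Multiplying by 1 +
      -- γ / (1 + β y) adds γ times a quotient series, so no Cauchy product is formed.
      expansion : ℕ → Series
      expansion zero      = divide 1# 𝟙
      expansion (suc k) j = expansion k j + γ k * divide (β k) (expansion k) j

      integral : ∀ k → Integral (expansion k)
      integral zero      = divide-integral v≥-1# 𝟙-integral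
      integral (suc k) j = v≥-+ (integral k j) (v≥-* (v≥-mono ℕ.z≤n (vγ k)) (divide-integral (vβ k) (integral k) j))

      increment : ∀ k j → v≥ k (expansion (suc k) j - expansion k j)
      increment k j = v≥-resp (solve 2 (λ a b → b := a :+ b :- a) refl _ _)
        (v≥-mono (ℕ.m≤m+n k 0) (v≥-* (vγ k) (divide-integral (vβ k) (integral k) j)))

      -- Division by 1 + β y leaves the constant term unchanged, so each step multiplies it by 1 +
      -- γ.
      constant-term : ∀ k → expansion k 0 ≈ ∏< k λ i → 1# + γ i
      constant-term zero    = refl
      constant-term (suc k) = trans (solve 2 (λ a g → a :+ g :* a := a :* (con 1ℤ :+ g)) refl _ _) (*-congʳ (constant-term k))

      converges : ∀ {y} → v≥ 1 y → ∀ k → Converges (partialSum (expansion k) y) ((1# + y) ⁻¹ * ∏< k (factor y))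
      converges {y} vy zero = Converges-cong (λ _ → refl)
        (trans (*-identityˡ _) (trans (⁻¹-cong (+-congˡ (*-identityˡ y))) (sym (*-identityʳ _))))
        (divide-converges v≥-1# 𝟙-integral vy (𝟙-converges y))
      converges {y} vy (suc k) = Converges-cong
        (λ J → trans (+-congˡ (sym (∑<-distribˡ-* J (γ k) _)))
          (trans (sym (∑<-distrib-+ J _ _)) (∑<-cong J λ j → solve 4 (λ a g b z → a :* z :+ g :* (b :* z) := (a :+ g :* b) :* z) refl _ _ _ _)))
        (solve 4 (λ u P g b → u :* P :+ g :* (u :* P :* b) := u :* (P :* (con 1ℤ :+ g :* b))) refl _ _ _ _)
        (Converges-+ (converges vy k) (Converges-* (γ k) (divide-converges (vβ k) (integral k) vy (converges vy k))))

      ε : Carrier → ℕ → Carrier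
      ε y k = γ k / (1# + β k * y)

      v≥-ε : ∀ {y} → v≥ 1 y → ∀ k → v≥ k (ε y k)
      v≥-ε vy k = v≥-mono (ℕ.m≤m+n k 0) (v≥-* (vγ k) (v≥-⁻¹ (v≥-* (vβ k) vy)))

      ∏-integral : ∀ {y} → v≥ 1 y → ∀ k → v≥ 0 (∏< k (factor y))
      ∏-integral vy zero    = v≥-1#
      ∏-integral vy (suc k) = v≥-* (∏-integral vy k) (v≥-+ v≥-1# (v≥-mono ℕ.z≤n (v≥-ε vy k)))

      abstract
        coefficient-limit : ∀ j → ∃[ a ] Converges (λ k → expansion k j) a × (∀ k → v≥ k (expansion k j - a))
        coefficient-limit j = limit complete (λ k → expansion k j) (λ k → increment k j)

        product-limit : ∀ {y} → v≥ 1 y → ∃[ w ] Converges (λ n → ∏< n (factor y)) w × (∀ k → v≥ k (∏< k (factor y) - w))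
        product-limit {y} vy = limit complete (λ n → ∏< n (factor y)) λ k → v≥-resp
          (solve 2 (λ P e → P :* e := P :* (con 1ℤ :+ e) :- P) refl _ _) (v≥-* (∏-integral vy k) (v≥-ε vy k))

    coefficient : Series
    coefficient j = proj₁ (coefficient-limit j)

    constant-coefficient : Converges (λ n → ∏< n λ i → 1# + γ i) (coefficient 0)
    constant-coefficient = Converges-cong constant-term refl (proj₁ (proj₂ (coefficient-limit 0)))

    product-expansion : ∀ {y} → v≥ 1 y → ∃[ w ] Converges (λ n → ∏< n (factor y)) w
                          × Converges (partialSum coefficient y) ((1# + y) ⁻¹ * w)
    product-expansion vy = let w , conv , _ = product-limit vy in
      w , conv , uniform-limit (v≥-mono ℕ.z≤n vy) (λ k j → proj₂ (proj₂ (coefficient-limit j)) k)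
        (converges vy) (Converges-* _ conv)

-- Growth of powers, and the derivative of 1/(t - e).

n<m^n : ∀ {m} → 2 ℕ.≤ m → ∀ n → n ℕ.< m ℕ.^ n
n<m^n         2≤m zero    = ℕ.≤-refl
n<m^n {m} 2≤m (suc n) = begin
  1 ℕ.+ suc n              ≤⟨ ℕ.+-mono-≤ (ℕ.≤-trans (ℕ.s≤s ℕ.z≤n) ih) (ℕ.≤-trans ih (ℕ.m≤m+n _ 0)) ⟩
  2 ℕ.* m ℕ.^ n            ≤⟨ ℕ.*-monoˡ-≤ (m ℕ.^ n) 2≤m ⟩
  m ℕ.^ suc n              ∎
  where
  open ℕ.≤-Reasoning
  ih = n<m^n 2≤m n

module InverseDerivative {c ℓ} (V : ValuedField c ℓ) where
  open ValuedField V hiding (zero)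
  open FieldProperties 𝔽
  open IntegerSolver commutativeRing
  open Valuation V
  open SetoidReasoning setoid

  -- With x = t - e, the error of the difference quotient is exactly h / (x² (x + h)). If v(x) ≤ m,
  -- precision k + 3m for h is enough; one more makes h strictly smaller than x, so that v(x + h) ≤
  -- m as well.
  inverse-derivative : ∀ {t e} → t - e ≉ 0# → HasDerivative (λ t → (t - e) ⁻¹) t (- ((t - e) ⁻¹ * (t - e) ⁻¹))
  inverse-derivative {t} {e} x≉0 r = ι (suc d) , λ h h≉0 vh → ≤⁺-trans [ r≤k ] (v≥-cancelʳ {k} {m ℕ.+ (m ℕ.+ m)}
    (v≥-resp (sym (quotient h h≉0 (v≥-mono (ℕ.s≤s m≤d) vh))) (v≥-mono (ℕ.n≤1+n d) vh))
    (v≤-* x≤m (v≤-* x≤m (v≤-+ x≤m (v≥-mono (ℕ.s≤s m≤d) vh)))))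
    where
    x = t - e
    m = proj₁ (v≤-exists x≉0)
    x≤m = proj₂ (v≤-exists x≉0)
    k = proj₁ (archimedean r)
    r≤k = proj₂ (archimedean r)
    d = k ℕ.+ (m ℕ.+ (m ℕ.+ m))

    m≤d : m ℕ.≤ d
    m≤d = ℕ.≤-trans (ℕ.m≤m+n m (m ℕ.+ m)) (ℕ.m≤n+m _ k)

    quotient : ∀ h → h ≉ 0# → v≥ (suc m) h →
      (((t + h - e) ⁻¹ - x ⁻¹) / h - - (x ⁻¹ * x ⁻¹)) * (x * (x * (x + h))) ≈ h
    quotient h h≉0 vh = begin
      (((t + h - e) ⁻¹ - X) * h ⁻¹ - - (X * X)) * (x * (x * (x + h)))
        ≈⟨ *-congʳ (+-congʳ (*-congʳ (+-congʳ (⁻¹-cong (solve 3 (λ t h e → t :+ h :- e := t :- e :+ h) refl t h e))))) ⟩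
      ((Y - X) * h ⁻¹ - - (X * X)) * (x * (x * (x + h)))
        ≈⟨ *-congʳ (+-congʳ (*-congʳ (⁻¹-difference x+h≉0 x≉0))) ⟩
      ((x - (x + h)) * (Y * X) * h ⁻¹ - - (X * X)) * (x * (x * (x + h)))
        ≈⟨ solve 5 (λ x h X Y g → ((x :- (x :+ h)) :* (Y :* X) :* g :- :- (X :* X)) :* (x :* (x :* (x :+ h)))
                     := (x :* X) :* ((x :* X) :* (x :+ h) :- ((x :+ h) :* Y) :* (h :* g) :* x)) refl x h X Y (h ⁻¹) ⟩
      (x * X) * ((x * X) * (x + h) - ((x + h) * Y) * (h * h ⁻¹) * x)
        ≈⟨ *-cong xX (+-cong (*-congʳ xX) (-‿cong (*-congʳ (*-cong (inverseʳ x+h≉0) (inverseʳ h≉0))))) ⟩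
      1# * (1# * (x + h) - 1# * 1# * x)
        ≈⟨ solve 2 (λ x h → con 1ℤ :* (con 1ℤ :* (x :+ h) :- con 1ℤ :* con 1ℤ :* x) := h) refl x h ⟩
      h ∎
      where
      X = x ⁻¹
      Y = (x + h) ⁻¹
      xX = inverseʳ x≉0
      x+h≉0 = v≤⇒≉0 (v≤-+ x≤m vh)

-- Frobenius, the conjugates of η, and the distance from θ to the other poles.

module Place {a ℓ c ℓ′} (S : Setting a ℓ c ℓ′) where
  open Setting S hiding (zero)
  open FieldProperties 𝔽
  open PolynomialFunctions 𝔽
  open IntegerSolver commutativeRing
  open Valuation ℂ∞
  open Polynomial commutativeRing using (⟦_⟧)
  open SetoidReasoning setoid
  private
    module F = Field 𝔽q
    module FF = FiniteField 𝔽q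
    module Fₚ = FieldProperties 𝔽q
    module em = IsRingHomomorphism em-isHom

  2≤q : 2 ℕ.≤ q
  2≤q = FF.2≤q q↔𝔽

  em-^ : ∀ b n → em (b F.^ n) ≈ em b ^ n
  em-^ b zero    = em.1#-homo
  em-^ b (suc n) = trans (em.*-homo _ _) (*-congˡ (em-^ b n))

  em-x^q : ∀ b → em b ^ q ≈ em b
  em-x^q b = trans (sym (em-^ b q)) (em.⟦⟧-cong (FF.x^q≈x q↔𝔽 b))

  em-≉ : ∀ {x y} → x F.≉ y → em x ≉ em y
  em-≉ {x} {y} x≉y eq = 1≉0 (begin
    1#                                    ≈⟨ em.1#-homo ⟨
    em F.1#                               ≈⟨ em.⟦⟧-cong (F.inverseʳ (Fₚ.x-y≉0 x≉y)) ⟨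
    em ((x F.- y) F.* (x F.- y) F.⁻¹)     ≈⟨ em.*-homo _ _ ⟩
    em (x F.- y) * _                      ≈⟨ *-congʳ (trans (em.+-homo _ _) (+-cong eq (em.-‿homo _))) ⟩
    (em y - em y) * _                     ≈⟨ *-congʳ (-‿inverseʳ _) ⟩
    0# * _                                ≈⟨ zeroˡ _ ⟩
    0#                                    ∎)

  -- The difference of the two sides has degree < q and vanishes at the q
  -- elements of 𝔽q.
  [x+1]^q : ∀ x → (x + 1#) ^ q ≈ x ^ q + 1#
  [x+1]^q x = x-y≈0⇒x≈y _ _ (trans (solve 2 (λ a b → a :- (b :+ con 1ℤ) := a :- b :+ :- con 1ℤ) refl _ _)
    (zero-of-roots (degree-+ (degree-[x+1]^-x^ q) (degree-const (ℕ.≤-trans (ℕ.s≤s ℕ.z≤n) 2≤q) (- 1#)))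
      (em ∘ Inverse.to q↔𝔽) (λ i j i≢j → em-≉ λ eq → i≢j (≡.trans (≡.sym (Inverse.strictlyInverseʳ q↔𝔽 i)) (≡.trans (Inverse.from-cong q↔𝔽 eq) (Inverse.strictlyInverseʳ q↔𝔽 j))))
      (root ∘ Inverse.to q↔𝔽) x))
    where
    root : ∀ b → (em b + 1#) ^ q - em b ^ q + - 1# ≈ 0#
    root b = begin
      (em b + 1#) ^ q - em b ^ q + - 1#      ≈⟨ +-congʳ (+-cong (^-congˡ q (sym em[b+1])) (-‿cong (em-x^q b))) ⟩
      em (b F.+ F.1#) ^ q - em b + - 1#      ≈⟨ +-congʳ (+-congʳ (trans (em-x^q _) em[b+1])) ⟩
      em b + 1# - em b + - 1#                ≈⟨ solve 1 (λ b → b :+ con 1ℤ :- b :+ :- con 1ℤ := con 0ℤ) refl (em b) ⟩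
      0#                                     ∎
      where
      em[b+1] : em (b F.+ F.1#) ≈ em b + 1#
      em[b+1] = trans (em.+-homo _ _) (+-congˡ em.1#-homo)

  0^n≈0 : ∀ {n} → 1 ℕ.≤ n → 0# ^ n ≈ 0#
  0^n≈0 {suc n} _ = zeroˡ _

  1≤q^ : ∀ k → 1 ℕ.≤ q ℕ.^ k
  1≤q^ k = ℕ.≤-trans (ℕ.s≤s ℕ.z≤n) (n<m^n 2≤q k)

  -- Both sides are homogeneous of degree q, so dividing by y reduces to the case y = 1; y = 0 is
  -- treated apart.
  frobenius-+ : ∀ x y → (x + y) ^ q ≈ x ^ q + y ^ q
  frobenius-+ x y with y ≟0
  ... | yes y≈0 = begin
    (x + y) ^ q     ≈⟨ ^-congˡ q (trans (+-congˡ y≈0) (+-identityʳ x)) ⟩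
    x ^ q           ≈⟨ +-identityʳ _ ⟨
    x ^ q + 0#      ≈⟨ +-congˡ (trans (^-congˡ q y≈0) (0^n≈0 (ℕ.≤-trans (ℕ.s≤s ℕ.z≤n) 2≤q))) ⟨
    x ^ q + y ^ q   ∎
  ... | no y≉0 = begin
    (x + y) ^ q                      ≈⟨ ^-congˡ q x+y ⟩
    ((x / y + 1#) * y) ^ q           ≈⟨ ^-distrib-* _ _ q ⟩
    (x / y + 1#) ^ q * y ^ q         ≈⟨ *-congʳ ([x+1]^q _) ⟩
    ((x / y) ^ q + 1#) * y ^ q       ≈⟨ trans (distribʳ _ _ _) (+-cong (sym (^-distrib-* _ _ q)) (*-identityˡ _)) ⟩
    (x / y * y) ^ q + y ^ q          ≈⟨ +-congʳ (^-congˡ q (x*y⁻¹*y≈x x y≉0)) ⟩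
    x ^ q + y ^ q                    ∎
    where
    x+y : x + y ≈ (x / y + 1#) * y
    x+y = sym (trans (distribʳ _ _ _) (+-cong (x*y⁻¹*y≈x x y≉0) (*-identityˡ y)))

  frobenius^-+ : ∀ k x y → (x + y) ^ (q ℕ.^ k) ≈ x ^ (q ℕ.^ k) + y ^ (q ℕ.^ k)
  frobenius^-+ zero    x y = trans (*-identityʳ _) (sym (+-cong (*-identityʳ x) (*-identityʳ y)))
  frobenius^-+ (suc k) x y = begin
    (x + y) ^ (q ℕ.* q ℕ.^ k)                          ≈⟨ ^-assocʳ _ q _ ⟨
    ((x + y) ^ q) ^ (q ℕ.^ k)                          ≈⟨ ^-congˡ (q ℕ.^ k) (frobenius-+ x y) ⟩
    (x ^ q + y ^ q) ^ (q ℕ.^ k)                        ≈⟨ frobenius^-+ k _ _ ⟩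
    (x ^ q) ^ (q ℕ.^ k) + (y ^ q) ^ (q ℕ.^ k)          ≈⟨ +-cong (^-assocʳ x q _) (^-assocʳ y q _) ⟩
    x ^ (q ℕ.* q ℕ.^ k) + y ^ (q ℕ.* q ℕ.^ k)          ∎

  frobenius^-minus : ∀ k x y → (x - y) ^ (q ℕ.^ k) ≈ x ^ (q ℕ.^ k) - y ^ (q ℕ.^ k)
  frobenius^-minus k x y = begin
    (x - y) ^ Q                     ≈⟨ solve 2 (λ a b → a := a :+ b :- b) refl _ (y ^ Q) ⟩
    (x - y) ^ Q + y ^ Q - y ^ Q     ≈⟨ +-congʳ (sym (frobenius^-+ k (x - y) y)) ⟩
    (x - y + y) ^ Q - y ^ Q         ≈⟨ +-congʳ (^-congˡ Q (solve 2 (λ x y → x :- y :+ y := x) refl x y)) ⟩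
    x ^ Q - y ^ Q                   ∎
    where Q = q ℕ.^ k

  -- The coefficients come from 𝔽q and are fixed by Frobenius, which therefore commutes with
  -- evaluation and sends roots of ρ to roots of ρ.
  ⟦map-em⟧-x^q : ∀ p x → ⟦ map em p ⟧ (x ^ q) ≈ ⟦ map em p ⟧ x ^ q
  ⟦map-em⟧-x^q []      x = sym (0^n≈0 (ℕ.≤-trans (ℕ.s≤s ℕ.z≤n) 2≤q))
  ⟦map-em⟧-x^q (b ∷ p) x = begin
    em b + x ^ q * ⟦ map em p ⟧ (x ^ q)        ≈⟨ +-cong (sym (em-x^q b)) (*-congˡ (⟦map-em⟧-x^q p x)) ⟩
    em b ^ q + x ^ q * ⟦ map em p ⟧ x ^ q      ≈⟨ +-congˡ (sym (^-distrib-* _ _ q)) ⟩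
    em b ^ q + (x * ⟦ map em p ⟧ x) ^ q        ≈⟨ frobenius-+ _ _ ⟨
    (em b + x * ⟦ map em p ⟧ x) ^ q            ∎

  x^q^[1+k] : ∀ x k → x ^ (q ℕ.^ suc k) ≈ (x ^ (q ℕ.^ k)) ^ q
  x^q^[1+k] x k = sym (trans (^-assocʳ x (q ℕ.^ k) q) (^-congʳ x (ℕ.*-comm (q ℕ.^ k) q)))

  ⟦⟧-cong : ∀ p {x y} → x ≈ y → ⟦ p ⟧ x ≈ ⟦ p ⟧ y
  ⟦⟧-cong []      x≈y = refl
  ⟦⟧-cong (b ∷ p) x≈y = +-congˡ (*-cong x≈y (⟦⟧-cong p x≈y))

  η⁽k⁾-root : ∀ k → ⟦ map em ρ ⟧ η⁽ k ⁾ ≈ 0#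
  η⁽k⁾-root zero    = trans (⟦⟧-cong (map em ρ) (*-identityʳ η)) η-root
  η⁽k⁾-root (suc k) = begin
    ⟦ map em ρ ⟧ η⁽ suc k ⁾     ≈⟨ ⟦⟧-cong (map em ρ) (x^q^[1+k] η k) ⟩
    ⟦ map em ρ ⟧ (η⁽ k ⁾ ^ q)   ≈⟨ ⟦map-em⟧-x^q ρ _ ⟩
    ⟦ map em ρ ⟧ η⁽ k ⁾ ^ q     ≈⟨ ^-congˡ q (η⁽k⁾-root k) ⟩
    0# ^ q                      ≈⟨ 0^n≈0 (ℕ.≤-trans (ℕ.s≤s ℕ.z≤n) 2≤q) ⟩
    0#                          ∎

  -- A zero at the transcendental θ would already make every coefficient of ρ vanish, contrary to
  -- the leading coefficient 1.
  ρ-not-identically-zero : ¬ (∀ x → ⟦ map em ρ ⟧ x ≈ 0#)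
  ρ-not-identically-zero ρ≈0 = F.1≉0 (F.trans (F.sym (proj₁ ρ-monic)) (θ-transcendental ρ (ρ≈0 θ) N))

  frobenius^-injective : ∀ k {x y} → x ^ (q ℕ.^ k) ≈ y ^ (q ℕ.^ k) → x ≈ y
  frobenius^-injective k {x} {y} eq with x - y ≟0
  ... | yes x-y≈0 = x-y≈0⇒x≈y x y x-y≈0
  ... | no  x-y≉0 = contradiction (trans (frobenius^-minus k x y) (trans (+-congʳ eq) (-‿inverseʳ _))) (x^n≉0 (q ℕ.^ k) x-y≉0)

  Periodic : Set ℓ′
  Periodic = ∃[ d ] η⁽ suc d ⁾ ≈ η

  η⁽m⁾≈η⁽n⁾⇒periodic : ∀ {m n} → m ℕ.< n → η⁽ m ⁾ ≈ η⁽ n ⁾ → Periodic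
  η⁽m⁾≈η⁽n⁾⇒periodic {m} {n} m<n eq = d , frobenius^-injective m (begin
    η⁽ suc d ⁾ ^ (q ℕ.^ m)           ≈⟨ ^-assocʳ η (q ℕ.^ suc d) (q ℕ.^ m) ⟩
    η ^ (q ℕ.^ suc d ℕ.* q ℕ.^ m)    ≈⟨ ^-congʳ η (≡.trans (≡.sym (ℕ.^-distribˡ-+-* q (suc d) m)) (≡.cong (q ℕ.^_) d+m)) ⟩
    η⁽ n ⁾                           ≈⟨ eq ⟨
    η⁽ m ⁾                           ∎)
    where
    d = n ∸ suc m
    d+m : suc d ℕ.+ m ≡ n
    d+m = ≡.trans (≡.sym (ℕ.+-suc d m)) (ℕ.m∸n+n≡m m<n)

  -- The conjugates η⁽ k ⁾ are roots of ρ, so they cannot all be distinct.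
  η-periodic : Periodic
  η-periodic with Fin.any? (λ (i : Fin L) → Fin.any? λ (j : Fin L) → ¬? (i Fin.≟ j) ×-dec (η⁽ toℕ i ⁾ ≟ η⁽ toℕ j ⁾))
    where L = length (map em ρ)
  -- A list of L coefficients has degree below L, so L distinct conjugates would force ρ to vanish
  -- everywhere.
  ... | no none = contradiction
    (zero-of-roots (⟦⟧-degree (map em ρ)) (λ i → η⁽ toℕ i ⁾) (λ i j i≢j eq → none (i , j , i≢j , eq)) (η⁽k⁾-root ∘ toℕ))
    ρ-not-identically-zero
  ... | yes (i , j , i≢j , eq) with ℕ.<-cmp (toℕ i) (toℕ j)
  ...   | tri< i<j _ _ = η⁽m⁾≈η⁽n⁾⇒periodic i<j eq
  ...   | tri≈ _ i≡j _ = contradiction (Fin.toℕ-injective i≡j) i≢j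
  ...   | tri> _ _ j<i = η⁽m⁾≈η⁽n⁾⇒periodic j<i (sym eq)

  -- An element fixed by a power of Frobenius cannot have positive valuation
  -- unless it is zero.
  η-η⁽k⁾-small : ∀ k → v≥ 1 (η - η⁽ k ⁾) → η - η⁽ k ⁾ ≈ 0#
  η-η⁽k⁾-small k vα = v≥-all⇒≈0 λ n → v≥-resp (fixed n) (v≥-mono (ℕ.<⇒≤ (n<m^n 2≤M n)) (v≥-^ (M ℕ.^ n) vα))
    where
    α = η - η⁽ k ⁾
    d = proj₁ η-periodic
    M = q ℕ.^ suc d

    2≤M : 2 ℕ.≤ M
    2≤M = ℕ.≤-trans (ℕ.s≤s (ℕ.s≤s ℕ.z≤n)) (n<m^n 2≤q (suc d))

    α^M : α ^ M ≈ α
    α^M = begin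
      α ^ M                          ≈⟨ frobenius^-minus (suc d) η η⁽ k ⁾ ⟩
      η ^ M - η⁽ k ⁾ ^ M             ≈⟨ +-congˡ (-‿cong (trans (^-assocʳ η (q ℕ.^ k) M) (trans (^-congʳ η (ℕ.*-comm (q ℕ.^ k) M)) (sym (^-assocʳ η M (q ℕ.^ k)))))) ⟩
      η ^ M - (η ^ M) ^ (q ℕ.^ k)    ≈⟨ +-cong (proj₂ η-periodic) (-‿cong (^-congˡ (q ℕ.^ k) (proj₂ η-periodic))) ⟩
      α                              ∎

    fixed : ∀ n → α ^ (M ℕ.^ n) ≈ α
    fixed zero    = *-identityʳ α
    fixed (suc n) = trans (sym (^-assocʳ α M _)) (trans (^-congˡ (M ℕ.^ n) α^M) (fixed n))

  π : Carrier
  π = θ - η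

  v≥-π : v≥ 1 π
  v≥-π = ≡.subst ([ 1ℚ ] ≤⁺_) (≡.sym v[θ-η]) ≤⁺-refl

  v≤-π : v≤ 1 π
  v≤-π = ≡.subst (_≤⁺ [ 1ℚ ]) (≡.sym v[θ-η]) ≤⁺-refl

  π≉0 : π ≉ 0#
  π≉0 = v≤⇒≉0 v≤-π

  π^q^ : ∀ k → π ^ (q ℕ.^ k) ≈ θ ^ (q ℕ.^ k) - η⁽ k ⁾
  π^q^ k = frobenius^-minus k θ η

  pole-distance : ∀ k → v≤ 1 (θ - θ ^ (q ℕ.^ suc k))
  pole-distance k with v≤-total 1 (θ - θ ^ (q ℕ.^ suc k))
  ... | inj₁ p = p
  -- Here η equals its conjugate, so `B` is π - π^Q; as Q ≥ 2, π dominates this difference.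
  ... | inj₂ p = v≤-resp (sym B≈) (v≤-+ v≤-π (v≥-neg (v≥-mono (ℕ.≤-trans (ℕ.s≤s (ℕ.s≤s ℕ.z≤n)) (n<m^n 2≤q (suc k))) (v≥-^ Q v≥-π))))
    where
    Q = q ℕ.^ suc k
    B = θ - θ ^ Q
    α = η - η⁽ suc k ⁾

    α≈ : B - π + π ^ Q ≈ α
    α≈ = trans (+-congˡ (π^q^ (suc k))) (solve 4 (λ a b c d → (a :- b) :- (a :- c) :+ (b :- d) := c :- d) refl θ (θ ^ Q) η η⁽ suc k ⁾)

    α≈0 : α ≈ 0#
    α≈0 = η-η⁽k⁾-small (suc k) (v≥-resp α≈ (v≥-+ (v≥-minus p v≥-π) (v≥-mono (1≤q^ (suc k)) (v≥-^ Q v≥-π))))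

    B≈ : B ≈ π - π ^ Q
    B≈ = begin
      B                              ≈⟨ solve 3 (λ B π z → B := (B :- π :+ z) :+ (π :- z)) refl B π (π ^ Q) ⟩
      B - π + π ^ Q + (π - π ^ Q)    ≈⟨ +-congʳ (trans α≈ α≈0) ⟩
      0# + (π - π ^ Q)               ≈⟨ +-identityˡ _ ⟩
      π - π ^ Q                      ∎

  -- The equation holds inside H, where σ can be applied to it.
  σ^Θ*[θ-η⁽k⁾]≈1 : ∀ k → σ^ k ΘH * (θ - η⁽ k ⁾) ≈ 1#
  σ^Θ*[θ-η⁽k⁾]≈1 = conjugate
    where
    module σ = IsRingIsomorphism σ-isAut

    θH : Σ Carrier H
    θH = θ , gen (inj₁ (gen (inj₂ refl)))

    η^H : ℕ → Σ Carrier H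
    η^H n = η ^ n , power n
      where
      power : ∀ n → H (η ^ n)
      power zero    = one
      power (suc n) = mul (gen (inj₂ refl)) (power n)

    σ-η^ : ∀ n → proj₁ (σ (η^H n)) ≈ (η ^ q) ^ n
    σ-η^ zero    = σ.1#-homo
    σ-η^ (suc n) = trans (σ.⟦⟧-cong refl) (trans (σ.*-homo ηH (η^H n)) (*-cong σ-η (σ-η^ n)))

    conjugate : ∀ k → σ^ k ΘH * (θ - η⁽ k ⁾) ≈ 1#
    conjugate zero    = trans (*-congˡ (+-congˡ (-‿cong (*-identityʳ η)))) (inverseˡ π≉0)
    conjugate (suc k) = begin
      σ^ (suc k) ΘH * (θ - η⁽ suc k ⁾)                 ≈⟨ *-congˡ (+-cong (sym (σ-fixK θH (gen (inj₂ refl)))) (-‿cong (sym (trans (σ-η^ (q ℕ.^ k)) (^-assocʳ η q _))))) ⟩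
      σ^ (suc k) ΘH * (proj₁ (σ θH) - proj₁ (σ ηₖ))    ≈⟨ *-congˡ (+-congˡ (sym (σ.-‿homo ηₖ))) ⟩
      σ^ (suc k) ΘH * (proj₁ (σ θH) + proj₁ (σ -ηₖ))   ≈⟨ *-congˡ (sym (σ.+-homo θH -ηₖ)) ⟩
      σ^ (suc k) ΘH * proj₁ (σ θ-ηₖ)                   ≈⟨ σ.*-homo Θₖ θ-ηₖ ⟨
      proj₁ (σ Θₖ[θ-ηₖ])                               ≈⟨ σ.⟦⟧-cong (conjugate k) ⟩
      proj₁ (σ (1# , one))                             ≈⟨ σ.1#-homo ⟩
      1#                                               ∎
      where
      Θₖ = fold ΘH σ k
      ηₖ = η^H (q ℕ.^ k)
      -ηₖ : Σ Carrier H
      -ηₖ = - proj₁ ηₖ , neg (proj₂ ηₖ)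
      θ-ηₖ : Σ Carrier H
      θ-ηₖ = proj₁ θH + proj₁ -ηₖ , add (proj₂ θH) (proj₂ -ηₖ)
      Θₖ[θ-ηₖ] : Σ Carrier H
      Θₖ[θ-ηₖ] = proj₁ Θₖ * proj₁ θ-ηₖ , mul (proj₂ Θₖ) (proj₂ θ-ηₖ)

  σ^-Θ : ∀ k → σ^ k ΘH ≈ (θ - η⁽ k ⁾) ⁻¹
  σ^-Θ k = sym (⁻¹-unique (σ^Θ*[θ-η⁽k⁾]≈1 k))

  σ^-Θ≉0 : ∀ k → σ^ k ΘH ≉ 0#
  σ^-Θ≉0 k = x*y≈1⇒y≉0 (trans (*-comm _ _) (σ^Θ*[θ-η⁽k⁾]≈1 k))

-- The factors of ω_f near θ.

module Factors {a ℓ c ℓ′} (S : Setting a ℓ c ℓ′) where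
  open Setting S hiding (zero)
  open FieldProperties 𝔽
  open IntegerSolver commutativeRing
  open Valuation ℂ∞
  open Place S
  open SetoidReasoning setoid

  -- With A = t - η⁽ k ⁾ and Z = Θ^(- q^k), a factor of ω_f is A / D for D = A - Z.
  factor-≈ : ∀ {A D Z} → A ≉ 0# → D ≉ 0# → Z ≉ 0# → A ≈ D + Z → Z ⁻¹ / (Z ⁻¹ - A ⁻¹) ≈ 1# + Z / D
  factor-≈ {A} {D} {Z} A≉0 D≉0 Z≉0 A≈ = /-unique difference≉0 (begin
    (1# + Z / D) * (Z ⁻¹ - A ⁻¹)             ≈⟨ *-congˡ difference ⟩
    (1# + Z / D) * (D * (Z ⁻¹ * A ⁻¹))       ≈⟨ solve 5 (λ Z D d z a → (con 1ℤ :+ Z :* d) :* (D :* (z :* a)) := (D :+ Z :* (D :* d)) :* a :* z) refl Z D (D ⁻¹) (Z ⁻¹) (A ⁻¹) ⟩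
    (D + Z * (D * D ⁻¹)) * A ⁻¹ * Z ⁻¹       ≈⟨ *-congʳ (*-congʳ (trans (+-congˡ (trans (*-congˡ (inverseʳ D≉0)) (*-identityʳ Z))) (sym A≈))) ⟩
    A * A ⁻¹ * Z ⁻¹                          ≈⟨ trans (*-congʳ (inverseʳ A≉0)) (*-identityˡ _) ⟩
    Z ⁻¹                                     ∎)
    where
    difference : Z ⁻¹ - A ⁻¹ ≈ D * (Z ⁻¹ * A ⁻¹)
    difference = trans (⁻¹-difference Z≉0 A≉0) (*-congʳ (trans (+-congʳ A≈) (solve 2 (λ D Z → D :+ Z :- Z := D) refl D Z)))
    difference≉0 : Z ⁻¹ - A ⁻¹ ≉ 0#
    difference≉0 eq = x*y≉0 D≉0 (x*y≉0 (x⁻¹≉0 Z≉0) (x⁻¹≉0 A≉0)) (trans (sym difference) eq)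

  Θ^≈ : ∀ n → Θ ^ n ≈ (π ^ n) ⁻¹
  Θ^≈ n = ^-distrib-⁻¹ n π≉0

  pole : ℕ → Carrier
  pole k = θ - θ ^ (q ℕ.^ suc k)

  -- With B = `pole k` and Q = q^(k+1), the denominator t - θ^Q is B + π y = B (1 + β y), and π^Q
  -- divided by it is γ / (1 + β y). Index k belongs to the factor k + 1 of ω_f.
  β γ : ℕ → Carrier
  β k = π / pole k
  γ k = π ^ (q ℕ.^ suc k) / pole k

  v≥-β : ∀ k → v≥ 0 (β k)
  v≥-β k = v≥-/ v≥-π (pole-distance k)

  v≥-γ : ∀ k → v≥ k (γ k)
  v≥-γ k = v≥-/ (v≥-mono (ℕ.≤-trans (ℕ.≤-reflexive (ℕ.+-comm k 1)) (ℕ.<⇒≤ (n<m^n 2≤q (suc k)))) (v≥-^ _ v≥-π)) (pole-distance k)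

  open PowerSeries ℂ∞ public
  open ProductExpansion ℂ∞-complete β γ v≥-β v≥-γ public

  ω-factor : Carrier → ℕ → Carrier
  ω-factor t k = Θ ^ (q ℕ.^ k) / (Θ ^ (q ℕ.^ k) - (t - η⁽ k ⁾) ⁻¹)

  ω-factor-suc : ∀ {t y} → v≥ 1 y → t ≈ θ + π * y → ∀ k → ω-factor t (suc k) ≈ factor y k
  ω-factor-suc {t} {y} vy t≈ k = begin
    ω-factor t (suc k)               ≈⟨ *-cong (Θ^≈ Q) (⁻¹-cong (+-congʳ (Θ^≈ Q))) ⟩
    Z ⁻¹ / (Z ⁻¹ - A ⁻¹)             ≈⟨ factor-≈ (v≤⇒≉0 v≤-A) (v≤⇒≉0 v≤-D) (x^n≉0 Q π≉0) A≈ ⟩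
    1# + Z / D                       ≈⟨ +-congˡ (*-congˡ (⁻¹-distrib-* B≉0 (1+u≉0 vu))) ⟩
    1# + Z * (B ⁻¹ * (1# + u) ⁻¹)    ≈⟨ +-congˡ (*-assoc _ _ _) ⟨
    factor y k                       ∎
    where
    Q = q ℕ.^ suc k
    Z = π ^ Q
    A = t - η⁽ suc k ⁾
    B = pole k
    B≉0 = v≤⇒≉0 (pole-distance k)
    u = β k * y
    vu : v≥ 1 u
    vu = v≥-* (v≥-β k) vy
    D = B * (1# + u)
    v≤-D : v≤ 1 D
    v≤-D = v≤-* (pole-distance k) (1+u-v≤ vu)

    A≈ : A ≈ D + Z
    A≈ = begin
      t - η⁽ suc k ⁾                                     ≈⟨ +-congʳ t≈ ⟩
      θ + π * y - η⁽ suc k ⁾                             ≈⟨ solve 4 (λ θ z e T → θ :+ z :- e := θ :- T :+ z :+ (T :- e)) refl θ (π * y) η⁽ suc k ⁾ (θ ^ Q) ⟩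
      B + π * y + (θ ^ Q - η⁽ suc k ⁾)                   ≈⟨ +-cong (+-congˡ (*-congʳ (sym (x*y⁻¹*y≈x π B≉0)))) (sym (π^q^ (suc k))) ⟩
      B + π / B * B * y + Z                              ≈⟨ +-congʳ (solve 4 (λ B p b y → B :+ p :* b :* B :* y := B :* (con 1ℤ :+ p :* b :* y)) refl B π (B ⁻¹) y) ⟩
      D + Z                                              ∎

    -- This makes `A ⁻¹` a genuine inverse rather than the default value at 0: `Z` has valuation at
    -- least 2 and cannot cancel `D`.
    v≤-A : v≤ 1 A
    v≤-A = v≤-resp (sym A≈) (v≤-+ v≤-D (v≥-mono (ℕ.≤-trans (ℕ.s≤s (ℕ.s≤s ℕ.z≤n)) (n<m^n 2≤q (suc k))) (v≥-^ Q v≥-π)))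

  factor-0 : ∀ k → factor 0# k ≈ 1# + γ k
  factor-0 k = +-congˡ (trans (*-congˡ (⁻¹-unique (trans (*-identityˡ _) (trans (+-congˡ (zeroʳ _)) (+-identityʳ 1#))))) (*-identityʳ _))

  -- Since σ^k Θ = 1/(θ - η⁽ k ⁾), the factors of the period are those of ω_f at t = θ, that is, at
  -- y = 0.
  period-product : Converges (λ n → ∏< n λ j → let k = suc j in
                     Θ ^ (q ℕ.^ k) / (Θ ^ (q ℕ.^ k) - σ^ k ΘH)) (coefficient 0)
  period-product = Converges-cong (λ n → ∏<-cong n λ k → sym (begin
    Θ ^ (q ℕ.^ suc k) / (Θ ^ (q ℕ.^ suc k) - σ^ (suc k) ΘH)   ≈⟨ *-congˡ (⁻¹-cong (+-congˡ (-‿cong (σ^-Θ (suc k))))) ⟩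
    ω-factor θ (suc k)                                        ≈⟨ ω-factor-suc (v≥-0# 1) (sym (trans (+-congˡ (zeroʳ π)) (+-identityʳ θ))) k ⟩
    factor 0# k                                               ≈⟨ factor-0 k ⟩
    1# + γ k                                                  ∎)) refl constant-coefficient

  -- Dividing by π lowers the bound from 2 to v(y) ≥ 1, which is what makes the powers of y tend to
  -- 0 and keeps 1 + β y away from 0.
  module Disc {t} (t≉θ : t ≉ θ) (vt : v≥ 2 (t - θ)) where
    h y : Carrier
    h = t - θ
    y = h * Θ

    h≉0 : h ≉ 0#
    h≉0 = x-y≉0 t≉θ

    vy : v≥ 1 y
    vy = v≥-/ vt v≤-π

    A≈ : t - η ≈ h + π
    A≈ = solve 3 (λ t e T → t :- e := t :- T :+ (T :- e)) refl t η θ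

    A≈π[1+y] : t - η ≈ π * (1# + y)
    A≈π[1+y] = trans A≈ (trans (+-congʳ (sym (x*y⁻¹*y≈x h π≉0))) (solve 3 (λ h p P → h :* p :* P :+ P := P :* (con 1ℤ :+ h :* p)) refl h Θ π))

    A≉0 : t - η ≉ 0#
    A≉0 eq = x*y≉0 π≉0 (1+u≉0 vy) (trans (sym A≈π[1+y]) eq)

    ω-factor-0 : ω-factor t 0 ≈ (t - η) / h
    ω-factor-0 = begin
      ω-factor t 0                             ≈⟨ *-cong (Θ^≈ 1) (⁻¹-cong (+-cong (Θ^≈ 1) (-‿cong (⁻¹-cong (+-congˡ (-‿cong (*-identityʳ η))))))) ⟩
      (π ^ 1) ⁻¹ / ((π ^ 1) ⁻¹ - (t - η) ⁻¹)   ≈⟨ factor-≈ A≉0 h≉0 (x^n≉0 1 π≉0) (trans A≈ (+-congˡ (sym (*-identityʳ π)))) ⟩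
      1# + π ^ 1 / h                           ≈⟨ +-cong (sym (inverseʳ h≉0)) (*-congʳ (*-identityʳ π)) ⟩
      h * h ⁻¹ + π * h ⁻¹                      ≈⟨ distribʳ _ _ _ ⟨
      (h + π) * h ⁻¹                           ≈⟨ *-congʳ (sym A≈) ⟩
      (t - η) / h                              ∎

    ω-product : ∀ {w} → Converges (λ n → ∏< n (factor y)) w → Converges (λ n → ∏< n (ω-factor t)) ((t - η) / h * w)
    ω-product conv = Converges-shift (Converges-cong (λ n → sym (trans (∏<-suc n (ω-factor t))
      (*-cong ω-factor-0 (∏<-cong n (ω-factor-suc vy t≈))))) refl (Converges-* _ conv))
      where
      t≈ : t ≈ θ + π * y
      t≈ = begin
        t                ≈⟨ solve 2 (λ t T → t := T :+ (t :- T)) refl t θ ⟩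
        θ + h            ≈⟨ +-congˡ (x*y⁻¹*y≈x h π≉0) ⟨
        θ + h * Θ * π    ≈⟨ +-congˡ (*-comm _ _) ⟩
        θ + π * y        ∎

  -- The Laurent expansion of the differential at θ.

  module ResidueOfω (rω : Carrier) where
    ω-d = ω-f rω ·d (λ t → (t - η) ⁻¹)

    -- As y = h Θ, the power Θ^j turns y^j into h^j. Entry j belongs to h^(j - 1) because of the
    -- simple pole, hence the shift in `laurentℤ`.
    laurent : ℕ → Carrier
    laurent j = - (rω * Θ) * (coefficient j * Θ ^ j)

    laurentℤ : ℤ → Carrier
    laurentℤ (+ n)        = laurent (suc n)
    laurentℤ -[1+ zero ]  = laurent 0
    laurentℤ -[1+ suc _ ] = 0#

    no-lower-terms : ∀ n → n ℤ.< -1ℤ → laurentℤ n ≈ 0#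
    no-lower-terms (+ n)        ()
    no-lower-terms -[1+ zero ]  (ℤ.-<- ())
    no-lower-terms -[1+ suc _ ] _ = refl

    module _ {t} (t≉θ : t ≉ θ) (vt : v≥ 2 (t - θ)) where
      open Disc t≉θ vt

      laurent-term : ∀ j → laurentℤ (j ℤ.⊖ 1) * h ^ℤ (j ℤ.⊖ 1) ≈ - (rω * Θ) / h * (coefficient j * y ^ j)
      laurent-term zero    = solve 3 (λ K b g → K :* (b :* con 1ℤ) :* (g :* con 1ℤ) := K :* g :* (b :* con 1ℤ)) refl (- (rω * Θ)) (coefficient 0) (h ⁻¹)
      laurent-term (suc j) = trans (absorb _ (coefficient (suc j)) (h ^ j) (Θ ^ suc j))
        (*-congˡ (*-congˡ (sym (^-distrib-* h Θ (suc j)))))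
        where
        absorb : ∀ C b x z → C * (b * z) * x ≈ C / h * (b * (h * x * z))
        absorb C b x z = begin
          C * (b * z) * x                  ≈⟨ *-identityˡ _ ⟨
          1# * (C * (b * z) * x)           ≈⟨ *-congʳ (inverseʳ h≉0) ⟨
          h * h ⁻¹ * (C * (b * z) * x)     ≈⟨ solve 6 (λ C h g b x z → h :* g :* (C :* (b :* z) :* x) := C :* g :* (b :* (h :* x :* z))) refl C h (h ⁻¹) b x z ⟩
          C / h * (b * (h * x * z))        ∎

      value : ∀ w → - (rω * Θ) / h * ((1# + y) ⁻¹ * w) ≈ rω * ((t - η) / h * w) * - ((t - η) ⁻¹ * (t - η) ⁻¹)
      value w = begin
        - (rω * Θ) / h * ((1# + y) ⁻¹ * w)             ≈⟨ solve 5 (λ r p g u w → :- (r :* p) :* g :* (u :* w) := :- (r :* g :* w) :* (p :* u)) refl rω Θ (h ⁻¹) ((1# + y) ⁻¹) w ⟩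
        - (rω * h ⁻¹ * w) * (Θ * (1# + y) ⁻¹)          ≈⟨ *-congˡ (trans (sym (⁻¹-distrib-* π≉0 (1+u≉0 vy))) (⁻¹-cong (sym A≈π[1+y]))) ⟩
        - (rω * h ⁻¹ * w) * X                          ≈⟨ *-congˡ (trans (sym (*-identityˡ X)) (*-congʳ (sym (inverseʳ A≉0)))) ⟩
        - (rω * h ⁻¹ * w) * ((t - η) * X * X)          ≈⟨ solve 5 (λ r g w A X → :- (r :* g :* w) :* (A :* X :* X) := r :* (A :* g :* w) :* :- (X :* X)) refl rω (h ⁻¹) w (t - η) X ⟩
        rω * ((t - η) / h * w) * - (X * X)             ∎
        where X = (t - η) ⁻¹

      expansion : ∃[ w ] ω-d t w × Converges (λ J → ∑< J λ j → laurentℤ (j ℤ.⊖ 1) * h ^ℤ (j ℤ.⊖ 1)) w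
      expansion = let w , product , series = product-expansion vy in
        _ , (_ , _ , (_ , ω-product product , refl) , InverseDerivative.inverse-derivative ℂ∞ A≉0 , value w) ,
        Converges-cong (λ J → trans (sym (∑<-distribˡ-* J _ _)) (∑<-cong J λ j → sym (laurent-term j))) refl
          (Converges-* (- (rω * Θ) / h) series)

    residue : ∀ {r} → r ≈ - (rω * Θ * coefficient 0) → Residue ω-d θ r
    -- The pole order 1 starts the expansion at index -1; `ι 2` is the radius on which v(y) ≥ 1.
    residue r≈ = 1 , laurentℤ , ι 2 , no-lower-terms
      , trans (solve 3 (λ r p b → :- (r :* p) :* (b :* con 1ℤ) := :- (r :* p :* b)) refl rω Θ (coefficient 0)) (sym r≈)
      , λ t t≉θ vt → expansion t≉θ vt

-- The three roots are chosen independently, and rescaling rω by a (q - 1)-th root of unity rescales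
-- the residue but leaves the period fixed. Compatible and arbitrary choices are therefore treated
-- separately.
theorem6 : ∀ {a ℓ c ℓ′} (S : Setting a ℓ c ℓ′) → let open Setting S in
    ∀ rC rπ rω →
    IsRoot (q ∸ 1) (ΘH ^σ (-1ℤ ∷ 0ℤ ∷ 1ℤ ∷ [])) rC →
    IsRoot (q ∸ 1) (- σ^ 2 ΘH) rπ →
    IsRoot (q ∸ 1) (- Θ) rω →
    let ω-d[1/t-η] = ω-f rω ·d (λ t → (t - η) ⁻¹) in
    ∃[ π̃Φ ] IsPeriodΦ rC rπ π̃Φ
    × (rω * rC ≈ rπ → Residue ω-d[1/t-η] θ (- π̃Φ))
    × (∃[ ζ ] ζ ^ (q ∸ 1) ≈ 1# × Residue ω-d[1/t-η] θ (- (ζ * π̃Φ)))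
theorem6 S rC rπ rω rC-root rπ-root rω-root =
  π̃Φ , (rπ * s₁ * P , (P , period-product , refl) , refl)
     , (λ rωrC≈rπ → residue (-‿cong (trans (sym (*-identityˡ π̃Φ)) (ζπ̃Φ≈ (trans rωrC≈rπ (sym (*-identityˡ rπ)))))))
     , rω * rC / rπ , ζ-root , residue (-‿cong (ζπ̃Φ≈ (sym (x*y⁻¹*y≈x (rω * rC) rπ≉0))))
  where
  open Setting S hiding (zero)
  open FieldProperties 𝔽
  open IntegerSolver commutativeRing
  open Place S
  open Factors S
  open ResidueOfω rω
  open SetoidReasoning setoid

  P = coefficient 0
  s₁ = σ^ 1 ΘH
  s₂ = σ^ 2 ΘH
  π̃Φ = rπ * s₁ * P / C₀₂ rC

  Θ≉0 : Θ ≉ 0#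
  Θ≉0 = x⁻¹≉0 π≉0

  root≉0 : ∀ {r x} → x ≉ 0# → IsRoot (q ∸ 1) x r → r ≉ 0#
  root≉0 x≉0 root r≈0 = x≉0 (trans (sym root) (trans (^-congˡ (q ∸ 1) r≈0) (0^n≈0 (ℕ.∸-monoˡ-≤ 1 2≤q))))

  -s₂≉0 : - s₂ ≉ 0#
  -s₂≉0 eq = σ^-Θ≉0 2 (trans (solve 1 (λ x → x := :- :- x) refl s₂) (trans (-‿cong eq) (solve 0 (:- con 0ℤ := con 0ℤ) refl)))

  rC-root′ : rC ^ (q ∸ 1) ≈ Θ ⁻¹ * s₂
  rC-root′ = trans rC-root (solve 2 (λ a b → (a :* con 1ℤ) :* (con 1ℤ :* ((b :* con 1ℤ) :* con 1ℤ)) := a :* b) refl (Θ ⁻¹) s₂)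

  rπ≉0 : rπ ≉ 0#
  rπ≉0 = root≉0 -s₂≉0 rπ-root

  rC≉0 : rC ≉ 0#
  rC≉0 = root≉0 (x*y≉0 (x⁻¹≉0 Θ≉0) (σ^-Θ≉0 2)) rC-root′

  C₀₂≈ : C₀₂ rC ≈ rC * (Θ ⁻¹ * s₁)
  C₀₂≈ = solve 3 (λ r a b → r :* ((a :* con 1ℤ) :* ((b :* con 1ℤ) :* con 1ℤ)) := r :* (a :* b)) refl rC (Θ ⁻¹) s₁

  C₀₂≉0 : C₀₂ rC ≉ 0#
  C₀₂≉0 eq = x*y≉0 rC≉0 (x*y≉0 (x⁻¹≉0 Θ≉0) (σ^-Θ≉0 1)) (trans (sym C₀₂≈) eq)

  -- Once C₀₂ is cleared, both sides contain the same σΘ and the same infinite product, and Θ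
  -- cancels against the Θ⁻¹ in C₀₂. Only the relation between the roots is left.
  ζπ̃Φ≈ : ∀ {ζ} → rω * rC ≈ ζ * rπ → ζ * π̃Φ ≈ rω * Θ * P
  ζπ̃Φ≈ {ζ} eq = *-cancelʳ C₀₂≉0 (begin
    ζ * π̃Φ * C₀₂ rC                        ≈⟨ trans (*-assoc _ _ _) (*-congˡ (x*y⁻¹*y≈x _ C₀₂≉0)) ⟩
    ζ * (rπ * s₁ * P)                      ≈⟨ solve 4 (λ z r s P → z :* (r :* s :* P) := (z :* r) :* s :* P) refl ζ rπ s₁ P ⟩
    ζ * rπ * s₁ * P                        ≈⟨ *-congʳ (*-congʳ (sym eq)) ⟩
    rω * rC * s₁ * P                       ≈⟨ trans (sym (*-identityˡ _)) (*-congʳ (sym (inverseʳ Θ≉0))) ⟩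
    Θ * Θ ⁻¹ * (rω * rC * s₁ * P)          ≈⟨ solve 6 (λ T U w C s P → T :* U :* (w :* C :* s :* P) := w :* T :* P :* (C :* (U :* s))) refl Θ (Θ ⁻¹) rω rC s₁ P ⟩
    rω * Θ * P * (rC * (Θ ⁻¹ * s₁))        ≈⟨ *-congˡ C₀₂≈ ⟨
    rω * Θ * P * C₀₂ rC                    ∎)

  -- On (q - 1)-th powers the radicands multiply as -Θ · Θ⁻¹ σ²Θ = -σ²Θ, the radicand of rπ.
  ζ-root : (rω * rC / rπ) ^ (q ∸ 1) ≈ 1#
  ζ-root = begin
    (rω * rC / rπ) ^ m                       ≈⟨ trans (^-distrib-* _ _ m) (*-cong (^-distrib-* _ _ m) (^-distrib-⁻¹ m rπ≉0)) ⟩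
    rω ^ m * rC ^ m / (rπ ^ m)               ≈⟨ *-cong (*-cong rω-root rC-root′) (⁻¹-cong rπ-root) ⟩
    - Θ * (Θ ⁻¹ * s₂) / (- s₂)               ≈⟨ *-congʳ (solve 3 (λ a b c → :- a :* (b :* c) := (a :* b) :* :- c) refl Θ (Θ ⁻¹) s₂) ⟩
    Θ * Θ ⁻¹ * - s₂ / (- s₂)                 ≈⟨ x*y*y⁻¹≈x _ -s₂≉0 ⟩
    Θ * Θ ⁻¹                                 ≈⟨ inverseʳ Θ≉0 ⟩
    1#                                       ∎
    where m = q ∸ 1
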